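{- For every fixed integer $r\ge1$ and every integer $k\ge1$, there is a deterministic $n^{O(\log k)}$-time reduction which maps a 3SAT instance on $n$ variables to a linear subspace $\mathcal{L}\subseteq\mathbb{F}_{2^r}^{N\times N}$ with $N=n^{O(\log k)}$, such that: (YES) if the input formula is satisfiable, then $\mathcal{L}$ contains a nonzero matrix of rank $1$; (NO) if the input formula is unsatisfiable, then $\mathcal{L}$ contains no nonzero matrix of rank at most $k$.
   Context: 3SAT is the problem of deciding satisfiability of a Boolean CNF formula in which every clause is a disjunction of three literals. $\mathbb{F}_{2^r}$ is the finite field with $2^r$ elements. -}

module Defs where

open import Level using (Level; _⊔_) renaming (suc to lsuc)
open import Algebra.Apartness.Bundles using (HeytingField; HeytingCommutativeRing)
open import Algebra.Bundles using (CommutativeRing)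
open import Data.Bool.Base using (Bool; true; false; not)
open import Data.Fin.Base using (Fin; zero; suc; toℕ)
open import Data.List.Base using (List; []; _∷_)
open import Data.List.Relation.Unary.All using (All)
open import Data.List.Relation.Unary.Unique.Propositional using (Unique)
open import Data.Nat.Base using (ℕ; zero; suc; _+_; _*_; _^_; _≤_)
open import Data.Nat.Logarithm using (⌈log₂_⌉)
open import Data.Product.Base using (Σ-syntax; ∃-syntax; _×_; _,_)
open import Data.Vec.Base as Vec using (Vec; []; _∷_; lookup; _[_]≔_; replicate)
open import Data.Vec.Relation.Unary.Any using (Any)
open import Data.Vec.Functional using (Vector)
open import Function.Bundles using (Inverse)
open import Relation.Binary.PropositionalEquality.Core using (_≡_)
open import Relation.Binary.PropositionalEquality.Properties using (setoid)
open import Relation.Nullary.Negation using (¬_)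
open import Relation.Unary using (Pred)
import Algebra.Properties.Monoid.Sum as MonoidSum

------------------------------------------------------------------------
-- 3SAT

data Literal (n : ℕ) : Set where
  pos neg : Fin n → Literal n

Clause : ℕ → Set
Clause n = Vec (Literal n) 3

-- The clauses are pairwise distinct, so a formula on n variables has at most
-- (2n)³ of them and a running time can be measured in n alone.
-- The three literals of a clause need not be distinct.
record 3CNF (n : ℕ) : Set where
  field
    clauses  : List (Clause n)
    distinct : Unique clauses

Assignment : ℕ → Set
Assignment n = Fin n → Bool

literalValue : ∀ {n} → Assignment n → Literal n → Bool
literalValue α (pos x) = α x
literalValue α (neg x) = not (α x)

Satisfies : ∀ {n} → Assignment n → 3CNF n → Set
Satisfies α φ = All (Any (λ l → literalValue α l ≡ true)) (3CNF.clauses φ)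

Satisfiable : ∀ {n} → 3CNF n → Set
Satisfiable φ = ∃[ α ] Satisfies α φ

------------------------------------------------------------------------
-- Finite fields

-- A field with exactly q elements. The bijection with Fin q fixes which symbol
-- represents which element when elements are written out by a program; being
-- finite, ≈ is decidable and every element that is not ≈ 0# is invertible.
record FiniteField (c ℓ₁ ℓ₂ : Level) (q : ℕ) : Set (lsuc (c ⊔ ℓ₁ ⊔ ℓ₂)) where
  field
    heytingField : HeytingField c ℓ₁ ℓ₂

  open HeytingField heytingField public using (heytingCommutativeRing)

  commutativeRing : CommutativeRing c ℓ₁
  commutativeRing = HeytingCommutativeRing.commutativeRing heytingCommutativeRing

  field
    enumeration : Inverse (CommutativeRing.setoid commutativeRing) (setoid (Fin q))

------------------------------------------------------------------------
-- Linear algebra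

module LinearAlgebra {c ℓ₁ ℓ₂ q} (F : FiniteField c ℓ₁ ℓ₂ q) where

  open CommutativeRing (FiniteField.commutativeRing F) public
    using (Carrier; _≈_; 0#)
  open CommutativeRing (FiniteField.commutativeRing F)
    using (+-monoid) renaming (_*_ to _·_)
  open MonoidSum +-monoid using (sum)

  combination : ∀ {I : Set} {d} → Vector Carrier d → Vector (I → Carrier) d → (I → Carrier)
  combination a b i = sum (λ l → a l · b l i)

  Span : ∀ {I : Set} {d} → Vector (I → Carrier) d → Pred (I → Carrier) (c ⊔ ℓ₁)
  Span b v = ∃[ a ] (∀ i → v i ≈ combination a b i)

  LinearlyIndependent : ∀ {I : Set} {d} → Vector (I → Carrier) d → Set (c ⊔ ℓ₁)
  LinearlyIndependent b = ∀ a → (∀ i → combination a b i ≈ 0#) → ∀ l → a l ≈ 0#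

  record HasDimension {I : Set} {p} (U : Pred (I → Carrier) p) (d : ℕ) : Set (c ⊔ ℓ₁ ⊔ p) where
    field
      basis       : Vector (I → Carrier) d
      inside      : ∀ l → U (basis l)
      independent : LinearlyIndependent basis
      spanning    : ∀ v → U v → Span basis v

  Matrix : ℕ → ℕ → Set c
  Matrix m n = Fin m × Fin n → Carrier

  NonZeroMatrix : ∀ {m n} → Matrix m n → Set ℓ₁
  NonZeroMatrix M = ¬ (∀ ij → M ij ≈ 0#)

  columns : ∀ {m n} → Matrix m n → Vector (Fin m → Carrier) n
  columns M j i = M (i , j)

  HasRank : ∀ {m n} → Matrix m n → ℕ → Set (c ⊔ ℓ₁)
  HasRank M ρ = HasDimension (Span (columns M)) ρ

  RankAtMost : ∀ {m n} → Matrix m n → ℕ → Set (c ⊔ ℓ₁)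
  RankAtMost M k = ∃[ ρ ] ρ ≤ k × HasRank M ρ

-- A linear subspace of the N × N matrices, presented by finitely many matrices
-- that span it (not required to be independent).
record MatrixSubspace {c ℓ₁ ℓ₂ q} (F : FiniteField c ℓ₁ ℓ₂ q) : Set c where
  open LinearAlgebra F
  field
    N          : ℕ
    size       : ℕ
    generators : Vector (Matrix N N) size

  member : Pred (Matrix N N) (c ⊔ ℓ₁)
  member = Span generators

------------------------------------------------------------------------
-- Deterministic time

-- The model is the WHILE language on binary trees with its step-counting
-- semantics (N. D. Jones, "Computability and Complexity from a Programming
-- Perspective"). Every evaluated operator costs one step and no operator
-- inspects more than the root of a tree, so, sharing subtrees, a t-step run
-- creates at most t new nodes and deepens a tree by at most t (which bounds the
-- length of every list in the output). Each program and store have at most one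
-- outcome, and running times agree with those of deterministic
-- Turing machines up to a polynomial, and n^{O(log k)} absorbs polynomials.

infixr 5 _∙_

data Tree : Set where
  nil : Tree
  _∙_ : Tree → Tree → Tree

head tail : Tree → Tree
head nil     = nil
head (s ∙ _) = s
tail nil     = nil
tail (_ ∙ t) = t

Store : ℕ → Set
Store m = Vec Tree m

data Expr (m : ℕ) : Set where
  var   : Fin m → Expr m
  nil   : Expr m
  cons  : Expr m → Expr m → Expr m
  hd tl : Expr m → Expr m

eval : ∀ {m} → Expr m → Store m → Tree
eval (var x)    σ = lookup σ x
eval nil        σ = nil
eval (cons e f) σ = eval e σ ∙ eval f σ
eval (hd e)     σ = head (eval e σ)
eval (tl e)     σ = tail (eval e σ)

cost : ∀ {m} → Expr m → ℕ
cost (var x)    = 1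
cost nil        = 1
cost (cons e f) = 1 + cost e + cost f
cost (hd e)     = 1 + cost e
cost (tl e)     = 1 + cost e

infix 6 _≔_
infixr 5 _⨾_
infix 4 if_then_else_ while_loop_

data Program (m : ℕ) : Set where
  _≔_           : Fin m → Expr m → Program m
  _⨾_           : Program m → Program m → Program m
  if_then_else_ : Expr m → Program m → Program m → Program m
  while_loop_   : Expr m → Program m → Program m

-- ⟨ P , σ ⟩⇓ τ [ t ]: started in store σ, P halts in store τ after t steps.
-- nil is false and every other tree is true.
data ⟨_,_⟩⇓_[_] {m : ℕ} : Program m → Store m → Store m → ℕ → Set where
  assign     : ∀ {x e σ} →
               ⟨ x ≔ e , σ ⟩⇓ (σ [ x ]≔ eval e σ) [ 1 + cost e ]
  seq        : ∀ {P Q σ τ υ s t} →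
               ⟨ P , σ ⟩⇓ τ [ s ] → ⟨ Q , τ ⟩⇓ υ [ t ] →
               ⟨ P ⨾ Q , σ ⟩⇓ υ [ s + t ]
  if-true    : ∀ {e P Q σ τ t u v} → eval e σ ≡ u ∙ v →
               ⟨ P , σ ⟩⇓ τ [ t ] →
               ⟨ if e then P else Q , σ ⟩⇓ τ [ 1 + cost e + t ]
  if-false   : ∀ {e P Q σ τ t} → eval e σ ≡ nil →
               ⟨ Q , σ ⟩⇓ τ [ t ] →
               ⟨ if e then P else Q , σ ⟩⇓ τ [ 1 + cost e + t ]
  while-true : ∀ {e P σ τ υ s t u v} → eval e σ ≡ u ∙ v →
               ⟨ P , σ ⟩⇓ τ [ s ] → ⟨ while e loop P , τ ⟩⇓ υ [ t ] →
               ⟨ while e loop P , σ ⟩⇓ υ [ 1 + cost e + s + t ]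
  while-false : ∀ {e P σ} → eval e σ ≡ nil →
               ⟨ while e loop P , σ ⟩⇓ σ [ 1 + cost e ]

-- The input is placed in variable zero, all other variables being nil, and the
-- output is read from variable zero.
_maps_to_within_ : ∀ {m} → Program (suc m) → Tree → Tree → ℕ → Set
_maps_to_within_ {m} P d e T =
  Σ[ σ ∈ Store m ] Σ[ t ∈ ℕ ] ⟨ P , d ∷ replicate m nil ⟩⇓ (e ∷ σ) [ t ] × t ≤ T

------------------------------------------------------------------------
-- Encodings as trees

-- Unary: all numbers that occur are variable indices, dimensions, or symbols
-- from a fixed alphabet.
encodeℕ : ℕ → Tree
encodeℕ zero    = nil
encodeℕ (suc n) = nil ∙ encodeℕ n

encodeFin : ∀ {n} → Fin n → Tree
encodeFin i = encodeℕ (toℕ i)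

encodeList : ∀ {a} {A : Set a} → (A → Tree) → List A → Tree
encodeList enc []       = nil
encodeList enc (x ∷ xs) = enc x ∙ encodeList enc xs

encodeVector : ∀ {a} {A : Set a} {n} → (A → Tree) → Vector A n → Tree
encodeVector {n = zero}  enc v = nil
encodeVector {n = suc n} enc v = enc (v zero) ∙ encodeVector enc (λ i → v (suc i))

encodeLiteral : ∀ {n} → Literal n → Tree
encodeLiteral (pos x) = nil ∙ encodeFin x
encodeLiteral (neg x) = (nil ∙ nil) ∙ encodeFin x

encodeFormula : ∀ {n} → 3CNF n → Tree
encodeFormula {n} φ = encodeℕ n ∙ encodeList encodeClause (3CNF.clauses φ)
  where
  encodeClause : Clause n → Tree
  encodeClause C = encodeList encodeLiteral (Vec.toList C)

module _ {c ℓ₁ ℓ₂ q} {F : FiniteField c ℓ₁ ℓ₂ q} where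
  open LinearAlgebra F

  encodeElement : Carrier → Tree
  encodeElement x = encodeFin (Inverse.to (FiniteField.enumeration F) x)

  -- row by row
  encodeMatrix : ∀ {m n} → Matrix m n → Tree
  encodeMatrix M = encodeVector (encodeVector encodeElement) (λ i j → M (i , j))

  encodeSubspace : MatrixSubspace F → Tree
  encodeSubspace L = encodeℕ N ∙ encodeVector encodeMatrix generators
    where open MatrixSubspace L

------------------------------------------------------------------------
-- Reductions from 3SAT

ComputableWithin : ∀ {c ℓ₁ ℓ₂ q} {F : FiniteField c ℓ₁ ℓ₂ q} →
                   (∀ {n} → 3CNF n → MatrixSubspace F) → (ℕ → ℕ) → Set
ComputableWithin f T =
  Σ[ m ∈ ℕ ] Σ[ P ∈ Program (suc m) ]
    (∀ {n} (φ : 3CNF n) → P maps encodeFormula φ to encodeSubspace (f φ) within T n)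

-- n^{O(log k)}, with C the constant hidden by O. The shifts only matter in the
-- degenerate cases: 2 + n keeps the base at least 2 when n ≤ 1, and
-- ⌈log₂ (1 + k)⌉, which is Θ(log k) for k ≥ 2, keeps the exponent positive at k = 1.
n^O[log_] : ℕ → ℕ → ℕ → ℕ
n^O[log k ] C n = (2 + n) ^ (C * ⌈log₂ suc k ⌉)

module Submission where

-- A formula is encoded by symmetric matrices indexed by the rows star, lit i j
-- and gad i, where y(a,b) is free unless choosing the literals a and b together
-- is inconsistent, in which case it is zero. The row gad i repeats
-- y(star,-) + Σ_j y(lit i j,-), but its diagonal block is zero. The subspace is
-- the t-th tensor power of this space, with 2 ^ t > k.
--
-- A satisfying assignment gives the vector z with z(star) = 1 and z(lit i j) = -1
-- for one true literal of every clause; its equations hold, so z zᵀ and its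
-- tensor powers lie in the spaces.
--
-- Conversely let M be a nonzero element of the t-th power, divided into blocks
-- that lie in the (t-1)-st power. By induction on t it contains a triangular
-- submatrix of size 2 ^ t, because some pair of nonzero blocks forms a
-- triangular 2 × 2 pattern. Indeed, otherwise every row with zero diagonal block
-- is zero, in particular every gad i, so the equations hold, and two rows with
-- nonzero diagonal blocks are consistent. If the block of star is nonzero, the
-- equations provide a nonzero lit i j in every clause, hence a satisfying
-- assignment; if it is zero, the equations make all diagonal blocks zero.
--
-- The matrices are written out by a program of a small functional language that
-- is compiled to WHILE with an exact running time.

open import Defs
open import Algebra.Apartness.Bundles using (HeytingField)
open import Algebra.Bundles using (CommutativeRing)
open import Data.Bool.Base using (Bool; true; false; not; _∧_; _∨_; T) renaming (if_then_else_ to ifᵇ_then_else_)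
open import Data.Bool.Properties using (∧-comm; ∨-comm; ∧-zeroʳ; T-≡)
open import Data.Fin.Base as Fin using (Fin; zero; suc; toℕ; combine)
open import Data.Fin.Properties as Fin using (any?; toℕ<n; toℕ-injective; injective⇒≤; combine-injective)
open import Data.List.Base as List using (List; []; _∷_; _++_; length; foldl; reverse; tabulate; allFin)
open import Data.List.Membership.Propositional using (_∈_)
open import Data.List.Membership.Propositional.Properties using (∈-lookup; ∈-map⁺; ∈-++⁺ˡ; ∈-++⁺ʳ; ∈-allFin)
open import Data.List.Properties using (length-map; length-++; length-replicate; length-reverse; length-tabulate; tabulate-lookup)
open import Data.List.Relation.Unary.All as All using (All; []; _∷_)
open import Data.List.Relation.Unary.All.Properties as All using ()
open import Data.List.Relation.Unary.AllPairs using ([]; _∷_)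
open import Data.List.Relation.Unary.Any as Any using (here; there)
open import Data.List.Relation.Unary.Any.Properties using (reverse⁺; lookup-index)
open import Data.List.Relation.Unary.Unique.Propositional using (Unique)
open import Data.Nat.Base as ℕ using (ℕ; zero; suc; _≤_; _<_; _^_; _≡ᵇ_; _≤ᵇ_; z≤n; s≤s)
open import Data.Nat.Induction using (<-rec)
open import Data.Nat.Logarithm using (⌈log₂_⌉; ⌈log₂⌉-mono-≤; ⌈log₂⌈n/2⌉⌉≡⌈log₂n⌉∸1)
import Data.Nat.Properties as ℕ
open import Data.Nat.Tactic.RingSolver using (solve-∀)
open import Data.Product.Base using (Σ-syntax; ∃-syntax; _×_; _,_; proj₁; proj₂)
open import Data.Sum.Base using (_⊎_; inj₁; inj₂)
open import Data.Unit.Polymorphic.Base using (⊤; tt)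
open import Data.Vec.Base as Vec using (Vec; []; _∷_)
open import Data.Vec.Functional using (Vector; removeAt)
open import Data.Vec.Relation.Unary.Any as VecAny using (here; there)
open import Function.Bundles using (Equivalence; Inverse)
open import Level using (Level; _⊔_)
open import Relation.Binary.PropositionalEquality
  using (_≡_; refl; sym; trans; cong; cong₂; subst)
open import Relation.Nullary.Decidable.Core using (Dec; yes; no; does; map′; ¬?; _×-dec_; decidable-stable)
open import Relation.Nullary.Negation using (¬_; contradiction)
import Algebra.Properties.Ring
import Algebra.Properties.Semiring.Sum
import Relation.Binary.Reasoning.Setoid

-- Rank alone does not amplify: elements of a tensor power are sums of pure tensors, and minimum
-- rank is not multiplicative. The field with 4 elements, inside the 2 × 2 matrices over the field
-- with 2 elements, has minimum rank 2, and so has its tensor square. Triangular submatrices do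
-- amplify: gluing two of them needs one zero block, and the opposite block may be arbitrary.
--
-- The equations are not imposed on y, which would call for a basis of their solution space. The
-- rows `gad i` leave y free and punish a violated equation by rank: by symmetry, a nonzero block
-- (p, q) beside a zero block (p, p) gives a triangular pattern in the rows p, q and the columns q,
-- p. Hence the generators are indexed by words of pairs of rows, every entry is 0 or 1 as decided
-- by a Boolean test, and the field enters the program only through the symbols of 0 and 1.

module _ where

  open import Data.Nat.Base
  open import Data.Nat.Properties

  -- A functional language on trees and its compilation to WHILE

  data Tm : Set where
    var  : ℕ → Tm
    nil  : Tm
    cons : Tm → Tm → Tm
    hd tl : Tm → Tm
    ite  : Tm → Tm → Tm → Tm
    bind : Tm → Tm → Tm
    fold : Tm → Tm → Tm → Tm

  tails : ℕ → Tree → Tree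
  tails zero    E = E
  tails (suc i) E = tail (tails i E)

  foldTree : (Tree → Tree → Tree) → Tree → Tree → Tree
  foldTree f nil      a = a
  foldTree f (x ∙ xs) a = foldTree f xs (f x a)

  branch : ∀ {ℓ} {A : Set ℓ} → Tree → A → A → A
  branch nil     x y = y
  branch (_ ∙ _) x y = x

  ⟦_⟧ : Tm → Tree → Tree
  ⟦ var i ⟧        E = head (tails i E)
  ⟦ nil ⟧          E = nil
  ⟦ cons e f ⟧     E = ⟦ e ⟧ E ∙ ⟦ f ⟧ E
  ⟦ hd e ⟧         E = head (⟦ e ⟧ E)
  ⟦ tl e ⟧         E = tail (⟦ e ⟧ E)
  ⟦ ite e f g ⟧    E = branch (⟦ e ⟧ E) (⟦ f ⟧ E) (⟦ g ⟧ E)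
  ⟦ bind e f ⟧     E = ⟦ f ⟧ (⟦ e ⟧ E ∙ E)
  ⟦ fold xs a f ⟧  E = foldTree (λ x b → ⟦ f ⟧ (x ∙ b ∙ E)) (⟦ xs ⟧ E) (⟦ a ⟧ E)

  -- The registers hold the last value, the environment and the stack.

  pattern A = zero
  pattern V = suc zero
  pattern S = suc (suc zero)

  tailsExpr : ℕ → Expr 3
  tailsExpr zero    = var V
  tailsExpr (suc i) = tl (tailsExpr i)

  -- Loop invariant: `A` holds the rest of the list and the top of the stack the accumulator. While
  -- `P` runs, the accumulator sits in the environment and the rest of the list takes its place on
  -- the stack.
  foldBody : Program 3 → Program 3
  foldBody P =
    V ≔ cons (hd (var A)) (cons (hd (var S)) (var V)) ⨾
    S ≔ cons (tl (var A)) (tl (var S)) ⨾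
    P ⨾
    V ≔ tl (tl (var V)) ⨾
    S ≔ cons (hd (var S)) (cons (var A) (tl (var S))) ⨾
    A ≔ hd (var S) ⨾
    S ≔ tl (var S)

  compile : Tm → Program 3
  compile (var i)       = A ≔ hd (tailsExpr i)
  compile nil           = A ≔ nil
  compile (cons e f)    = compile e ⨾ S ≔ cons (var A) (var S) ⨾ compile f ⨾
                          A ≔ cons (hd (var S)) (var A) ⨾ S ≔ tl (var S)
  compile (hd e)        = compile e ⨾ A ≔ hd (var A)
  compile (tl e)        = compile e ⨾ A ≔ tl (var A)
  compile (ite e f g)   = compile e ⨾ (if var A then compile f else compile g)
  compile (bind e f)    = compile e ⨾ V ≔ cons (var A) (var V) ⨾ compile f ⨾ V ≔ tl (var V)
  compile (fold xs a f) = compile a ⨾ S ≔ cons (var A) (var S) ⨾ compile xs ⨾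
                          (while var A loop foldBody (compile f)) ⨾
                          A ≔ hd (var S) ⨾ S ≔ tl (var S)

  -- 2 steps for the loop test; 14 and 18 for the assignments of `foldBody` before and after the
  -- body.
  foldTime : (Tree → Tree → Tree) → (Tree → Tree → ℕ) → Tree → Tree → ℕ
  foldTime f g nil      a = 2
  foldTime f g (x ∙ xs) a = 2 + (14 + (g x a + 18)) + foldTime f g xs (f x a)

  -- Exact, and bracketed like the nested sequences in `compile`, so that the step counts in
  -- `compile-correct` agree by computation.
  time : Tm → Tree → ℕ
  time (var i)       E = 1 + cost (hd (tailsExpr i))
  time nil           E = 2
  time (cons e f)    E = time e E + (4 + (time f E + 8))
  time (hd e)        E = time e E + 3
  time (tl e)        E = time e E + 3
  time (ite e f g)   E = time e E + (2 + branch (⟦ e ⟧ E) (time f E) (time g E))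
  time (bind e f)    E = time e E + (4 + (time f (⟦ e ⟧ E ∙ E) + 3))
  time (fold xs a f) E = time a E + (4 + (time xs E +
    (foldTime (λ x b → ⟦ f ⟧ (x ∙ b ∙ E)) (λ x b → time f (x ∙ b ∙ E)) (⟦ xs ⟧ E) (⟦ a ⟧ E) + 6)))

  eval-tails : ∀ i {a E s} → eval (tailsExpr i) (a ∷ E ∷ s ∷ []) ≡ tails i E
  eval-tails zero    = refl
  eval-tails (suc i) = cong tail (eval-tails i)

  compile-correct : ∀ e a E s → ⟨ compile e , a ∷ E ∷ s ∷ [] ⟩⇓ ⟦ e ⟧ E ∷ E ∷ s ∷ [] [ time e E ]

  while-correct : ∀ f E s xs a →
    ⟨ while var A loop foldBody (compile f) , xs ∷ E ∷ (a ∙ s) ∷ [] ⟩⇓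
    nil ∷ E ∷ (foldTree (λ x b → ⟦ f ⟧ (x ∙ b ∙ E)) xs a ∙ s) ∷ []
    [ foldTime (λ x b → ⟦ f ⟧ (x ∙ b ∙ E)) (λ x b → time f (x ∙ b ∙ E)) xs a ]
  while-correct f E s nil      a = while-false refl
  while-correct f E s (x ∙ xs) a = while-true refl
    (seq assign (seq assign (seq (compile-correct f _ _ _)
      (seq assign (seq assign (seq assign assign))))))
    (while-correct f E s xs _)

  compile-correct (var i)     a E s =
    subst (λ v → ⟨ _ , _ ⟩⇓ head v ∷ E ∷ s ∷ [] [ _ ]) (eval-tails i) assign
  compile-correct nil         a E s = assign
  compile-correct (cons e f)  a E s =
    seq (compile-correct e _ _ _) (seq assign (seq (compile-correct f _ _ _) (seq assign assign)))
  compile-correct (hd e)      a E s = seq (compile-correct e _ _ _) assign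
  compile-correct (tl e)      a E s = seq (compile-correct e _ _ _) assign
  compile-correct (ite e f g) a E s with ⟦ e ⟧ E in eq | compile-correct e a E s
  ... | nil   | d = seq d (if-false refl (compile-correct g _ _ _))
  ... | _ ∙ _ | d = seq d (if-true refl (compile-correct f _ _ _))
  compile-correct (bind e f)  a E s =
    seq (compile-correct e _ _ _) (seq assign (seq (compile-correct f _ _ _) assign))
  compile-correct (fold xs a f) b E s =
    seq (compile-correct a _ _ _) (seq assign (seq (compile-correct xs _ _ _)
      (seq (while-correct f E s _ _) (seq assign assign))))

  -- The extra assignment, of 4 steps, makes the input the only entry of the environment.
  maps-to : ∀ e d {v T} → ⟦ e ⟧ (d ∙ nil) ≡ v → time e (d ∙ nil) ≤ T →
            (V ≔ cons (var A) (var V) ⨾ compile e) maps d to v within (4 + T)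
  maps-to e d refl t≤T = _ , _ , seq assign (compile-correct e _ _ _) , +-monoʳ-≤ 4 t≤T

  -- Specifications with upper bounds on the time

  infix 3 _⊢_⇒_within_

  record _⊢_⇒_within_ (E : Tree) (e : Tm) (v : Tree) (B : ℕ) : Set where
    constructor spec
    field
      value : ⟦ e ⟧ E ≡ v
      bound : time e E ≤ B

  open _⊢_⇒_within_

  weaken : ∀ {E e v B B′} → B ≤ B′ → E ⊢ e ⇒ v within B → E ⊢ e ⇒ v within B′
  weaken B≤B′ (spec p q) = spec p (≤-trans q B≤B′)

  ⊢subst : ∀ {E e v w B} → v ≡ w → E ⊢ e ⇒ v within B → E ⊢ e ⇒ w within B
  ⊢subst refl p = p

  direct : ∀ {E} e → E ⊢ e ⇒ ⟦ e ⟧ E within time e E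
  direct e = spec refl ≤-refl

  ⊢cons : ∀ {E e f v w B B′} → E ⊢ e ⇒ v within B → E ⊢ f ⇒ w within B′ →
          E ⊢ cons e f ⇒ v ∙ w within B + (4 + (B′ + 8))
  ⊢cons (spec refl p) (spec refl q) = spec refl (+-mono-≤ p (+-monoʳ-≤ 4 (+-monoˡ-≤ 8 q)))

  ⊢tl : ∀ {E e v B} → E ⊢ e ⇒ v within B → E ⊢ tl e ⇒ tail v within B + 3
  ⊢tl (spec refl p) = spec refl (+-monoˡ-≤ 3 p)

  ⊢bind : ∀ {E e f v w B B′} → E ⊢ e ⇒ v within B → v ∙ E ⊢ f ⇒ w within B′ →
          E ⊢ bind e f ⇒ w within B + (4 + (B′ + 3))
  ⊢bind (spec refl p) (spec refl q) = spec refl (+-mono-≤ p (+-monoʳ-≤ 4 (+-monoˡ-≤ 3 q)))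

  branch-true : ∀ {ℓ} {X : Set ℓ} {c u v} {x y : X} → c ≡ u ∙ v → branch c x y ≡ x
  branch-true refl = refl

  branch-false : ∀ {ℓ} {X : Set ℓ} {c} {x y : X} → c ≡ nil → branch c x y ≡ y
  branch-false refl = refl

  ⊢ite-true : ∀ {E e f g u v w B B′} → E ⊢ e ⇒ u ∙ v within B → E ⊢ f ⇒ w within B′ →
              E ⊢ ite e f g ⇒ w within B + (2 + B′)
  ⊢ite-true (spec p b) (spec q b′) = spec (trans (branch-true p) q)
    (+-mono-≤ b (+-monoʳ-≤ 2 (≤-trans (≤-reflexive (branch-true p)) b′)))

  ⊢ite-false : ∀ {E e f g w B B′} → E ⊢ e ⇒ nil within B → E ⊢ g ⇒ w within B′ →
               E ⊢ ite e f g ⇒ w within B + (2 + B′)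
  ⊢ite-false (spec p b) (spec q b′) = spec (trans (branch-false p) q)
    (+-mono-≤ b (+-monoʳ-≤ 2 (≤-trans (≤-reflexive (branch-false p)) b′)))

  bool : Bool → Tree
  bool true  = nil ∙ nil
  bool false = nil

  ⊢ite : ∀ {E e f g v w B B₁ B₂} b → E ⊢ e ⇒ bool b within B →
         E ⊢ f ⇒ v within B₁ → E ⊢ g ⇒ w within B₂ →
         E ⊢ ite e f g ⇒ (ifᵇ b then v else w) within B + (2 + (B₁ + B₂))
  ⊢ite {B = B} {B₁} true  p q r = weaken (+-monoʳ-≤ B (+-monoʳ-≤ 2 (m≤m+n _ _))) (⊢ite-true p q)
  ⊢ite {B = B} {B₁} false p q r = weaken (+-monoʳ-≤ B (+-monoʳ-≤ 2 (m≤n+m _ B₁))) (⊢ite-false p r)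

  module _ {a b} {X : Set a} {Y : Set b} (encX : X → Tree) (encY : Y → Tree)
           (f : X → Y → Y) {E body B}
           (step : ∀ x y → encX x ∙ encY y ∙ E ⊢ body ⇒ encY (f x y) within B) where

    fold-value : ∀ xs y → foldTree (λ x y → ⟦ body ⟧ (x ∙ y ∙ E)) (encodeList encX xs) (encY y) ≡
                 encY (foldl (λ y x → f x y) y xs)
    fold-value []       y = refl
    fold-value (x ∷ xs) y rewrite value (step x y) = fold-value xs (f x y)

    fold-bound : ∀ xs y →
      foldTime (λ x y → ⟦ body ⟧ (x ∙ y ∙ E)) (λ x y → time body (x ∙ y ∙ E)) (encodeList encX xs) (encY y)
      ≤ length xs * (2 + (14 + (B + 18))) + 2
    fold-bound []       y = ≤-refl
    fold-bound (x ∷ xs) y rewrite value (step x y) = ≤-trans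
      (+-mono-≤ (+-monoʳ-≤ 16 (+-monoˡ-≤ 18 (bound (step x y)))) (fold-bound xs (f x y)))
      (≤-reflexive (sym (+-assoc (2 + (14 + (B + 18))) _ 2)))

  foldBound : ℕ → ℕ → ℕ → ℕ → ℕ
  foldBound Bi Bx L B = Bi + (4 + (Bx + (L * (2 + (14 + (B + 18))) + 2 + 6)))

  ⊢fold : ∀ {a b} {X : Set a} {Y : Set b} (encX : X → Tree) (encY : Y → Tree) (f : X → Y → Y)
          {E exs ey body xs y Bx By B L} →
          E ⊢ exs ⇒ encodeList encX xs within Bx → length xs ≤ L →
          E ⊢ ey ⇒ encY y within By →
          (∀ x y → encX x ∙ encY y ∙ E ⊢ body ⇒ encY (f x y) within B) →
          E ⊢ fold exs ey body ⇒ encY (foldl (λ y x → f x y) y xs) within foldBound By Bx L B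
  ⊢fold encX encY f {xs = xs} {y} {B = B} (spec p b) len (spec q c) step = spec
    (trans (cong₂ (foldTree _) p q) (fold-value encX encY f step xs y))
    (+-mono-≤ c (+-monoʳ-≤ 4 (+-mono-≤ b (+-monoˡ-≤ 6 (≤-trans
      (≤-reflexive (cong₂ (foldTime _ _) p q))
      (≤-trans (fold-bound encX encY f step xs y)
        (+-monoˡ-≤ 2 (*-monoˡ-≤ (2 + (14 + (B + 18))) len))))))))

  -- The result comes out reversed, since the list is accumulated from the front.
  mapTm : Tm → Tm → Tm
  mapTm xs f = fold xs nil (cons f (var 1))

  encode-map : ∀ {a b} {X : Set a} {Y : Set b} (enc : Y → Tree) (f : X → Y) xs →
               encodeList enc (List.map f xs) ≡ encodeList (λ x → enc (f x)) xs
  encode-map enc f []       = refl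
  encode-map enc f (x ∷ xs) = cong (enc (f x) ∙_) (encode-map enc f xs)

  ⊢map : ∀ {a} {X : Set a} (encX : X → Tree) (g : X → Tree) {E exs body xs Bx B L} →
         E ⊢ exs ⇒ encodeList encX xs within Bx → length xs ≤ L →
         (∀ x y → encX x ∙ y ∙ E ⊢ body ⇒ g x within B) →
         E ⊢ mapTm exs body ⇒ encodeList g (reverse xs) within foldBound 2 Bx L (B + (4 + (4 + 8)))
  ⊢map encX g p len step =
    ⊢fold encX (encodeList g) _∷_ p len (spec refl ≤-refl)
      (λ x ys → ⊢cons (step x _) (direct (var 1)))

  cartesian : ∀ {a b} {X : Set a} {Y : Set b} → List X → List Y → List (X × Y)
  cartesian xs ys = foldl (λ acc x → foldl (λ acc y → (x , y) ∷ acc) acc ys) [] xs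

  cartesianTm : ℕ → ℕ → Tm
  cartesianTm i j = fold (var i) nil
    (fold (var (2 + j)) (var 1) (cons (cons (var 2) (var 0)) (var 1)))

  encodePair : ∀ {a b} {X : Set a} {Y : Set b} → (X → Tree) → (Y → Tree) → X × Y → Tree
  encodePair encX encY (x , y) = encX x ∙ encY y

  shift : ∀ j {x y E} → tails (2 + j) (x ∙ y ∙ E) ≡ tails j E
  shift zero    = refl
  shift (suc j) = cong tail (shift j)

  varTime : ℕ → ℕ
  varTime i = 1 + cost (hd (tailsExpr i))

  cartesianBound : ℕ → ℕ → ℕ → ℕ → ℕ
  cartesianBound i j L L′ = foldBound 2 (varTime i) L (foldBound 4 (varTime (2 + j)) L′ 36)

  ⊢cartesian : ∀ {a b} {X : Set a} {Y : Set b} (encX : X → Tree) (encY : Y → Tree) {E} i j {xs ys L L′} →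
    head (tails i E) ≡ encodeList encX xs → head (tails j E) ≡ encodeList encY ys →
    length xs ≤ L → length ys ≤ L′ →
    E ⊢ cartesianTm i j ⇒ encodeList (encodePair encX encY) (cartesian xs ys)
      within cartesianBound i j L L′
  ⊢cartesian encX encY i j {xs} {ys} p q len len′ =
    ⊢fold encX (encodeList (encodePair encX encY))
      (λ x acc → foldl (λ acc y → (x , y) ∷ acc) acc ys)
      (spec p ≤-refl) len (spec refl ≤-refl)
      (λ x acc → ⊢fold encY (encodeList (encodePair encX encY)) (λ y acc → (x , y) ∷ acc)
        (spec (trans (cong head (shift j)) q) ≤-refl) len′ (spec refl ≤-refl)
        (λ y acc → spec refl ≤-refl))

  length-cartesian : ∀ {a b} {X : Set a} {Y : Set b} (xs : List X) (ys : List Y) →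
                     length (cartesian xs ys) ≡ length xs * length ys
  length-cartesian {X = X} {Y} xs ys = trans (outer xs []) (+-identityʳ _)
    where
    inner : ∀ x (zs : List Y) acc → length (foldl (λ acc y → (x , y) ∷ acc) acc zs) ≡ length zs + length acc
    inner x []       acc = refl
    inner x (z ∷ zs) acc = trans (inner x zs _) (+-suc (length zs) (length acc))
    outer : ∀ zs (acc : List (X × Y)) →
            length (foldl (λ acc x → foldl (λ acc y → (x , y) ∷ acc) acc ys) acc zs) ≡
            length zs * length ys + length acc
    outer []       acc = refl
    outer (z ∷ zs) acc = trans (outer zs _)
      (trans (cong (length zs * length ys +_) (inner z ys acc))
      (trans (sym (+-assoc (length zs * length ys) (length ys) (length acc)))
             (cong (_+ length acc) (+-comm (length zs * length ys) (length ys)))))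

  powers : ∀ {a} {X : Set a} → List X → ∀ t → List (Vec X t)
  powers xs zero    = [] ∷ []
  powers xs (suc t) = List.map (λ (x , v) → x ∷ v) (cartesian xs (powers xs t))

  encodeVec : ∀ {a} {X : Set a} {t} → (X → Tree) → Vec X t → Tree
  encodeVec enc []      = nil
  encodeVec enc (x ∷ v) = enc x ∙ encodeVec enc v

  powersTm : ℕ → ℕ → Tm
  powersTm i zero    = cons nil nil
  powersTm i (suc t) = bind (powersTm i t) (cartesianTm (suc i) 0)

  powersBound : ℕ → ℕ → ℕ → ℕ
  powersBound i s zero    = 16
  powersBound i s (suc t) = powersBound i s t + (4 + (cartesianBound (suc i) 0 s (s ^ t) + 3))

  length-powers : ∀ {a} {X : Set a} (xs : List X) t → length (powers xs t) ≡ length xs ^ t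
  length-powers xs zero    = refl
  length-powers xs (suc t) = trans (length-map _ (cartesian xs (powers xs t)))
    (trans (length-cartesian xs (powers xs t)) (cong (length xs *_) (length-powers xs t)))

  tails-suc : ∀ i {x E} → tails (suc i) (x ∙ E) ≡ tails i E
  tails-suc zero    = refl
  tails-suc (suc i) = cong tail (tails-suc i)

  ⊢powers : ∀ {a} {X : Set a} (enc : X → Tree) {E} i t {xs s} →
            head (tails i E) ≡ encodeList enc xs → length xs ≤ s →
            E ⊢ powersTm i t ⇒ encodeList (encodeVec enc) (powers xs t) within powersBound i s t
  ⊢powers enc i zero    p len = spec refl ≤-refl
  ⊢powers enc {E} i (suc t) {xs} {s} p len =
    ⊢bind (⊢powers enc i t p len)
      (⊢subst (sym (encode-map _ _ (cartesian xs (powers xs t))))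
        (⊢cartesian enc (encodeVec enc) (suc i) 0 {ys = powers xs t} {L′ = s ^ t} (trans (cong head (tails-suc i)) p) refl len
          (≤-trans (≤-reflexive (length-powers xs t)) (^-monoˡ-≤ t len))))

  -- One tail of `f` per element of the unary number `e`, that is, `f` minus `e`. Two numbers are
  -- equal when both truncated differences vanish, which is the test in `eqTm`.
  monusTm : Tm → Tm → Tm
  monusTm e f = fold e f (tl (var 1))

  eqTm : Tm → Tm → Tm
  eqTm e f = ite (monusTm e f) nil (ite (monusTm f e) nil (cons nil nil))

  encodeℕ-replicate : ∀ x → encodeℕ x ≡ encodeList {A = Tree} (λ _ → nil) (List.replicate x nil)
  encodeℕ-replicate zero    = refl
  encodeℕ-replicate (suc x) = cong (nil ∙_) (encodeℕ-replicate x)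

  tail-encodeℕ : ∀ x → tail (encodeℕ x) ≡ encodeℕ (pred x)
  tail-encodeℕ zero    = refl
  tail-encodeℕ (suc x) = refl

  foldl-pred : ∀ x y → foldl (λ y (_ : Tree) → pred y) y (List.replicate x nil) ≡ y ∸ x
  foldl-pred zero    y = refl
  foldl-pred (suc x) y = trans (foldl-pred x (pred y)) (pred∸ y x)
    where
    pred∸ : ∀ y x → pred y ∸ x ≡ y ∸ suc x
    pred∸ zero    x = 0∸n≡0 x
    pred∸ (suc y) x = refl

  ⊢monus : ∀ {E e f x y L B B′} → E ⊢ e ⇒ encodeℕ x within B → x ≤ L →
           E ⊢ f ⇒ encodeℕ y within B′ →
           E ⊢ monusTm e f ⇒ encodeℕ (y ∸ x) within foldBound B′ B L 7
  ⊢monus {x = x} {y} p x≤L q = ⊢subst (cong encodeℕ (foldl-pred x y))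
    (⊢fold {X = Tree} (λ _ → nil) encodeℕ (λ _ → pred)
      (⊢subst (encodeℕ-replicate x) p)
      (≤-trans (≤-reflexive (length-replicate x)) x≤L) q
      (λ _ z → spec (tail-encodeℕ z) ≤-refl))

  ≡ᵇ-∸ : ∀ x y → branch (encodeℕ (y ∸ x)) nil (branch (encodeℕ (x ∸ y)) nil (nil ∙ nil)) ≡ bool (x ≡ᵇ y)
  ≡ᵇ-∸ zero    zero    = refl
  ≡ᵇ-∸ zero    (suc y) = refl
  ≡ᵇ-∸ (suc x) zero    = refl
  ≡ᵇ-∸ (suc x) (suc y) = ≡ᵇ-∸ x y

  branch-≤ : ∀ c {x y B B′} → x ≤ B → y ≤ B′ → branch c x y ≤ B + B′
  branch-≤ nil     {B = B} p q = ≤-trans q (m≤n+m _ B)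
  branch-≤ (_ ∙ _) p q = ≤-trans p (m≤m+n _ _)

  ⊢branch : ∀ {E e f g u v w B B₁ B₂} → E ⊢ e ⇒ u within B → E ⊢ f ⇒ v within B₁ →
            E ⊢ g ⇒ w within B₂ → E ⊢ ite e f g ⇒ branch u v w within B + (2 + (B₁ + B₂))
  ⊢branch (spec refl p) (spec refl q) (spec refl r) =
    spec refl (+-mono-≤ p (+-monoʳ-≤ 2 (branch-≤ _ q r)))

  -- Bounds k * Q, where Q exceeds every number that is compared, so that only
  -- the numeral k has to be tracked.

  module Scaled (Q : ℕ) (Q>0 : 0 < Q) where

    infix 3 _⊢_⇒_at_

    record _⊢_⇒_at_ (E : Tree) (e : Tm) (v : Tree) (k : ℕ) : Set where
      constructor at
      field unscaled : E ⊢ e ⇒ v within k * Q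

    open _⊢_⇒_at_ public

    scale : ∀ k → k ≤ k * Q
    scale k = m≤m*n k Q {{>-nonZero Q>0}}

    add : ∀ k l {x y} → x ≤ k * Q → y ≤ l * Q → x + y ≤ (k + l) * Q
    add k l p q = ≤-trans (+-mono-≤ p q) (≤-reflexive (sym (*-distribʳ-+ Q k l)))

    const-at : ∀ {E e v k} → E ⊢ e ⇒ v within k → E ⊢ e ⇒ v at k
    const-at {k = k} p = at (weaken (scale k) p)

    raise-≤ : ∀ {E e v k l} → k ≤ l → E ⊢ e ⇒ v at k → E ⊢ e ⇒ v at l
    raise-≤ k≤l (at p) = at (weaken (*-monoˡ-≤ Q k≤l) p)

    raise : ∀ {E e v k l} {_ : T (k ≤ᵇ l)} → E ⊢ e ⇒ v at k → E ⊢ e ⇒ v at l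
    raise {k = k} {l} {k≤l} = raise-≤ (≤ᵇ⇒≤ k l k≤l)

    at-hd : ∀ {E e v k} → E ⊢ e ⇒ v at k → E ⊢ hd e ⇒ head v at (k + 3)
    at-hd {k = k} (at (spec refl p)) = at (spec refl (add k 3 p (scale 3)))

    at-tl : ∀ {E e v k} → E ⊢ e ⇒ v at k → E ⊢ tl e ⇒ tail v at (k + 3)
    at-tl {k = k} (at (spec refl p)) = at (spec refl (add k 3 p (scale 3)))

    at-branch : ∀ {E e f g u v w k k₁ k₂} → E ⊢ e ⇒ u at k → E ⊢ f ⇒ v at k₁ → E ⊢ g ⇒ w at k₂ →
                E ⊢ ite e f g ⇒ branch u v w at (k + (2 + (k₁ + k₂)))
    at-branch {k = k} {k₁} {k₂} (at p) (at q) (at r) = at (weaken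
      (add k (2 + (k₁ + k₂)) ≤-refl (add 2 (k₁ + k₂) (scale 2) (add k₁ k₂ ≤-refl ≤-refl)))
      (⊢branch p q r))

    at-true : ∀ {E} → E ⊢ cons nil nil ⇒ bool true at 16
    at-true = const-at (spec refl ≤-refl)

    at-nil : ∀ {E} → E ⊢ nil ⇒ nil at 2
    at-nil = const-at (spec refl ≤-refl)

    -- There are at most Q iterations of 16 + 7 + 18 = 41 steps; the remaining 2 + 6 steps are
    -- absorbed as 8 * Q, which makes 49.
    at-monus : ∀ {E e f x y k l} → E ⊢ e ⇒ encodeℕ x at k → x ≤ Q → E ⊢ f ⇒ encodeℕ y at l →
               E ⊢ monusTm e f ⇒ encodeℕ (y ∸ x) at (l + (4 + (k + 49)))
    at-monus {k = k} {l} (at p) x≤Q (at q) = at (weaken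
      (add l (4 + (k + 49)) ≤-refl (add 4 (k + 49) (scale 4) (add k 49 ≤-refl
        (add 43 6 (add 41 2 (≤-reflexive (*-comm Q 41)) (scale 2)) (scale 6)))))
      (⊢monus p x≤Q q))

    at-eq : ∀ {E e f x y k} → E ⊢ e ⇒ encodeℕ x at k → x ≤ Q → E ⊢ f ⇒ encodeℕ y at k → y ≤ Q →
            E ⊢ eqTm e f ⇒ bool (x ≡ᵇ y) at
              ((k + (4 + (k + 49))) + (2 + (2 + ((k + (4 + (k + 49))) + (2 + (2 + 16))))))
    at-eq {x = x} {y} p x≤Q q y≤Q = at (⊢subst (≡ᵇ-∸ x y) (unscaled
      (at-branch (at-monus p x≤Q q) at-nil (at-branch (at-monus q y≤Q p) at-nil at-true))))

    at-subst : ∀ {E e v w k} → v ≡ w → E ⊢ e ⇒ v at k → E ⊢ e ⇒ w at k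
    at-subst refl p = p

  -- Rows, compatibility and generator matrices

  _==_ : ∀ {n} → Fin n → Fin n → Bool
  i == j = toℕ i ≡ᵇ toℕ j

  -- star is the homogenising coordinate, lit i j stands for "the j-th literal of
  -- clause i is chosen to be true", and gad i carries the linear equation
  -- "star plus the three lit i j is zero".
  data Row (c : ℕ) : Set where
    star : Row c
    lit  : Fin c → Fin 3 → Row c
    gad  : Fin c → Row c

  isGad : ∀ {c} → Row c → Bool
  isGad (gad _) = true
  isGad _       = false

  -- The first row read as a linear form with coefficients 0 and 1 in the coordinates `star` and
  -- `lit i j`: a coordinate is its own unit vector, `gad i` is the left side of its equation. Since
  -- `gad i` is not a coordinate, nothing covers it.
  covers : ∀ {c} → Row c → Row c → Bool
  covers star      star        = true
  covers star      (lit _ _)   = false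
  covers (lit _ _) star        = false
  covers (lit i j) (lit i′ j′) = (i == i′) ∧ (j == j′)
  covers (gad _)   star        = true
  covers (gad i)   (lit i′ _)  = i == i′
  covers _         (gad _)     = false

  contradictory : ∀ {n} → Literal n → Literal n → Bool
  contradictory (pos x) (neg y) = x == y
  contradictory (neg x) (pos y) = x == y
  contradictory _       _       = false

  module Design {n c : ℕ} (L : Fin c → Fin 3 → Literal n) where

    compatible : Row c → Row c → Bool
    compatible (lit i j) (lit i′ j′) =
      ifᵇ i == i′ then j == j′ else not (contradictory (L i j) (L i′ j′))
    compatible _         _           = true

    -- The symmetric matrix with y(p,q) = y(q,p) = 1. A disjunction instead of a sum keeps the
    -- entries for p = q from becoming 2, which is zero in characteristic 2. For p ≠ q both
    -- disjuncts can hold only between two gad rows, where `gen` puts zero.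
    pairing : Row c × Row c → Row c → Row c → Bool
    pairing (p , q) a b = covers a p ∧ covers b q ∨ covers a q ∧ covers b p

    -- An incompatible pair stays in the list as the zero matrix, so the generators form a full
    -- cartesian product.
    gen : Row c × Row c → Row c → Row c → Bool
    gen (p , q) a b = compatible p q ∧ (not (isGad a ∧ isGad b) ∧ pairing (p , q) a b)

    entry : ∀ {t} → Vec (Row c × Row c) t → Vec (Row c) t → Vec (Row c) t → Bool
    entry []      []      []      = true
    entry (g ∷ γ) (a ∷ r) (b ∷ s) = gen g a b ∧ entry γ r s

    -- A literal row carries its literal, so compatibility is tested without consulting the formula.
    -- The root and its head tell the three kinds of rows apart.
    encodeRow : Row c → Tree
    encodeRow star      = nil
    encodeRow (lit i j) = (encodeFin j ∙ encodeLiteral (L i j)) ∙ encodeFin i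
    encodeRow (gad i)   = nil ∙ encodeFin i

  -- Computing an entry of a generator

  andTm : Tm → Tm → Tm
  andTm e f = ite e f nil

  orTm : Tm → Tm → Tm
  orTm e f = ite e (cons nil nil) f

  notTm : Tm → Tm
  notTm e = ite e nil (cons nil nil)

  isGadTm : Tm → Tm
  isGadTm e = ite e (ite (hd e) nil (cons nil nil)) nil

  sameClauseTm samePositionTm coversTm contradictoryTm compatibleTm : Tm → Tm → Tm
  sameClauseTm e f    = eqTm (tl e) (tl f)
  samePositionTm e f  = eqTm (hd (hd e)) (hd (hd f))
  coversTm e f        =
    ite f
      (ite (hd f)
        (ite e (ite (hd e) (andTm (sameClauseTm e f) (samePositionTm e f)) (sameClauseTm e f)) nil)
        nil)
      (ite e (ite (hd e) nil (cons nil nil)) (cons nil nil))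
  contradictoryTm e f =
    ite (hd (tl (hd e)))
      (ite (hd (tl (hd f))) nil (eqTm (tl (tl (hd e))) (tl (tl (hd f)))))
      (ite (hd (tl (hd f))) (eqTm (tl (tl (hd e))) (tl (tl (hd f)))) nil)
  compatibleTm e f    =
    ite (hd e)
      (ite (hd f) (ite (sameClauseTm e f) (samePositionTm e f) (notTm (contradictoryTm e f))) (cons nil nil))
      (cons nil nil)

  genTm : Tm
  genTm = andTm (compatibleTm p q) (andTm (notTm (andTm (isGadTm a) (isGadTm b)))
    (orTm (andTm (coversTm a p) (coversTm b q)) (andTm (coversTm a q) (coversTm b p))))
    where
    a = hd (var 1)
    b = hd (var 0)
    p = hd (hd (var 2))
    q = tl (hd (var 2))

  -- The environment holds a column, a row and a generator; after pushing the tail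
  -- of each, the next one to be shortened is again at index 2.
  entryTm : ℕ → Tm
  entryTm zero    = cons nil nil
  entryTm (suc t) = andTm genTm
    (bind (tl (var 2)) (bind (tl (var 2)) (bind (tl (var 2)) (entryTm t))))

  bool-not : ∀ b → branch (bool b) nil (nil ∙ nil) ≡ bool (not b)
  bool-not true  = refl
  bool-not false = refl

  bool-∧ : ∀ b b′ → branch (bool b) (bool b′) nil ≡ bool (b ∧ b′)
  bool-∧ true  b′ = refl
  bool-∧ false b′ = refl

  bool-∨ : ∀ b b′ → branch (bool b) (nil ∙ nil) (bool b′) ≡ bool (b ∨ b′)
  bool-∨ true  b′ = refl
  bool-∨ false b′ = refl

  bool-if : ∀ b b′ b″ → branch (bool b) (bool b′) (bool b″) ≡ bool (ifᵇ b then b′ else b″)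
  bool-if true  b′ b″ = refl
  bool-if false b′ b″ = refl

  opaque
    -- The bounds combined in `at-gen` add up to 6178, so 20000 leaves ample room. Its value is
    -- hidden so that later arithmetic does not unfold it.
    genScale : ℕ
    genScale = 20000

    ≤-genScale : ∀ k → T (k ≤ᵇ 20000) → k ≤ genScale
    ≤-genScale k = ≤ᵇ⇒≤ k 20000

  module Tests {n c : ℕ} (L : Fin c → Fin 3 → Literal n) where

    open Design L

    -- Compared numbers are positions below 3, clause indices below c and variables below n.
    Q : ℕ
    Q = 3 + (c + n)

    open Scaled Q (s≤s z≤n)

    at-and : ∀ {E e f b b′ k k′} → E ⊢ e ⇒ bool b at k → E ⊢ f ⇒ bool b′ at k′ →
             E ⊢ andTm e f ⇒ bool (b ∧ b′) at (k + (2 + (k′ + 2)))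
    at-and {b = b} {b′} p q = at-subst (bool-∧ b b′) (at-branch p q at-nil)

    at-or : ∀ {E e f b b′ k k′} → E ⊢ e ⇒ bool b at k → E ⊢ f ⇒ bool b′ at k′ →
            E ⊢ orTm e f ⇒ bool (b ∨ b′) at (k + (2 + (16 + k′)))
    at-or {b = b} {b′} p q = at-subst (bool-∨ b b′) (at-branch p at-true q)

    at-not : ∀ {E e b k} → E ⊢ e ⇒ bool b at k → E ⊢ notTm e ⇒ bool (not b) at (k + (2 + (2 + 16)))
    at-not {b = b} p = at-subst (bool-not b) (at-branch p at-nil at-true)

    clauseIndex position variableIndex : Row c → ℕ
    clauseIndex star      = 0
    clauseIndex (lit i _) = toℕ i
    clauseIndex (gad i)   = toℕ i
    position (lit _ j) = toℕ j
    position _         = 0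
    variableIndex (lit i j) with L i j
    ... | pos x = toℕ x
    ... | neg x = toℕ x
    variableIndex _ = 0

    clauseIndex-tree : ∀ a → tail (encodeRow a) ≡ encodeℕ (clauseIndex a)
    clauseIndex-tree star      = refl
    clauseIndex-tree (lit _ _) = refl
    clauseIndex-tree (gad _)   = refl

    position-tree : ∀ a → head (head (encodeRow a)) ≡ encodeℕ (position a)
    position-tree star      = refl
    position-tree (lit _ _) = refl
    position-tree (gad _)   = refl

    variable-tree : ∀ a → tail (tail (head (encodeRow a))) ≡ encodeℕ (variableIndex a)
    variable-tree star      = refl
    variable-tree (lit i j) with L i j
    ... | pos x = refl
    ... | neg x = refl
    variable-tree (gad _)   = refl

    clauseIndex-≤ : ∀ a → clauseIndex a ≤ Q
    clauseIndex-≤ star      = z≤n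
    clauseIndex-≤ (lit i _) = ≤-trans (<⇒≤ (toℕ<n i)) (≤-trans (m≤m+n c n) (m≤n+m _ 3))
    clauseIndex-≤ (gad i)   = ≤-trans (<⇒≤ (toℕ<n i)) (≤-trans (m≤m+n c n) (m≤n+m _ 3))

    position-≤ : ∀ a → position a ≤ Q
    position-≤ star      = z≤n
    position-≤ (lit _ j) = ≤-trans (<⇒≤ (toℕ<n j)) (m≤m+n 3 _)
    position-≤ (gad _)   = z≤n

    variable-≤ : ∀ a → variableIndex a ≤ Q
    variable-≤ star      = z≤n
    variable-≤ (lit i j) with L i j
    ... | pos x = ≤-trans (<⇒≤ (toℕ<n x)) (≤-trans (m≤n+m n c) (m≤n+m _ 3))
    ... | neg x = ≤-trans (<⇒≤ (toℕ<n x)) (≤-trans (m≤n+m n c) (m≤n+m _ 3))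
    variable-≤ (gad _)   = z≤n

    -- 11 is the cost of the slowest fetch of a row in `genTm`: 5 + 3 + 3 for `hd (hd (var 2))`.
    module _ {E e f a b} (⊢e : E ⊢ e ⇒ encodeRow a at 11) (⊢f : E ⊢ f ⇒ encodeRow b at 11) where

      at-sameClause : E ⊢ sameClauseTm e f ⇒ bool (clauseIndex a ≡ᵇ clauseIndex b) at 200
      at-sameClause = raise (at-eq
        (at-subst (clauseIndex-tree a) (at-tl ⊢e)) (clauseIndex-≤ a)
        (at-subst (clauseIndex-tree b) (at-tl ⊢f)) (clauseIndex-≤ b))

      at-samePosition : E ⊢ samePositionTm e f ⇒ bool (position a ≡ᵇ position b) at 200
      at-samePosition = raise (at-eq
        (at-subst (position-tree a) (at-hd (at-hd ⊢e))) (position-≤ a)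
        (at-subst (position-tree b) (at-hd (at-hd ⊢f))) (position-≤ b))

      at-sameVariable : E ⊢ eqTm (tl (tl (hd e))) (tl (tl (hd f))) ⇒ bool (variableIndex a ≡ᵇ variableIndex b) at 220
      at-sameVariable = raise (at-eq
        (at-subst (variable-tree a) (at-tl (at-tl (at-hd ⊢e)))) (variable-≤ a)
        (at-subst (variable-tree b) (at-tl (at-tl (at-hd ⊢f)))) (variable-≤ b))

      at-covers : E ⊢ coversTm e f ⇒ bool (covers a b) at 1000
      at-covers = at-subst (evaluated a b)
        (raise (at-branch ⊢f
          (at-branch (at-hd ⊢f)
            (at-branch ⊢e (at-branch (at-hd ⊢e) (at-and at-sameClause at-samePosition) at-sameClause) at-nil)
            at-nil)
          (at-branch ⊢e (at-branch (at-hd ⊢e) at-nil at-true) at-true)))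
        where
        evaluated : ∀ a b → branch (encodeRow b)
          (branch (head (encodeRow b))
            (branch (encodeRow a)
              (branch (head (encodeRow a))
                (bool ((clauseIndex a ≡ᵇ clauseIndex b) ∧ (position a ≡ᵇ position b)))
                (bool (clauseIndex a ≡ᵇ clauseIndex b)))
              nil)
            nil)
          (branch (encodeRow a) (branch (head (encodeRow a)) nil (nil ∙ nil)) (nil ∙ nil))
          ≡ bool (covers a b)
        evaluated star      star        = refl
        evaluated star      (lit _ _)   = refl
        evaluated star      (gad _)     = refl
        evaluated (lit _ _) star        = refl
        evaluated (lit _ _) (lit _ _)   = refl
        evaluated (lit _ _) (gad _)     = refl
        evaluated (gad _)   star        = refl
        evaluated (gad _)   (lit _ _)   = refl
        evaluated (gad _)   (gad _)     = refl

      sign : Row c → Tree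
      sign a = head (tail (head (encodeRow a)))

      -- Arbitrary rows are allowed, although only literal rows have signs and variables, because
      -- `at-branch` also asks for the value of the branch not taken. `contradictory-value`
      -- specialises to two literal rows.
      at-contradictory : E ⊢ contradictoryTm e f ⇒
        branch (sign a)
          (branch (sign b) nil (bool (variableIndex a ≡ᵇ variableIndex b)))
          (branch (sign b) (bool (variableIndex a ≡ᵇ variableIndex b)) nil) at 1000
      at-contradictory = raise (at-branch (at-hd (at-tl (at-hd ⊢e)))
        (at-branch (at-hd (at-tl (at-hd ⊢f))) at-nil at-sameVariable)
        (at-branch (at-hd (at-tl (at-hd ⊢f))) at-sameVariable at-nil))

      at-compatible : E ⊢ compatibleTm e f ⇒ bool (compatible a b) at 2000
      at-compatible = at-subst (evaluated a b)
        (raise (at-branch (at-hd ⊢e)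
          (at-branch (at-hd ⊢f)
            (at-branch at-sameClause at-samePosition (at-branch at-contradictory at-nil at-true))
            at-true)
          at-true))
        where
        contradictory-value : ∀ i j i′ j′ →
          branch (sign (lit i j))
            (branch (sign (lit i′ j′)) nil (bool (variableIndex (lit i j) ≡ᵇ variableIndex (lit i′ j′))))
            (branch (sign (lit i′ j′)) (bool (variableIndex (lit i j) ≡ᵇ variableIndex (lit i′ j′))) nil)
          ≡ bool (contradictory (L i j) (L i′ j′))
        contradictory-value i j i′ j′ with L i j | L i′ j′
        ... | pos _ | pos _ = refl
        ... | pos _ | neg _ = refl
        ... | neg _ | pos _ = refl
        ... | neg _ | neg _ = refl
        evaluated : ∀ a b → branch (head (encodeRow a))
          (branch (head (encodeRow b))
            (branch (bool (clauseIndex a ≡ᵇ clauseIndex b)) (bool (position a ≡ᵇ position b))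
              (branch (branch (sign a)
                (branch (sign b) nil (bool (variableIndex a ≡ᵇ variableIndex b)))
                (branch (sign b) (bool (variableIndex a ≡ᵇ variableIndex b)) nil)) nil (nil ∙ nil)))
            (nil ∙ nil))
          (nil ∙ nil) ≡ bool (compatible a b)
        evaluated (lit i j) (lit i′ j′) rewrite contradictory-value i j i′ j′
          | bool-not (contradictory (L i j) (L i′ j′)) = bool-if (i == i′) (j == j′) _
        evaluated (lit _ _) star        = refl
        evaluated (lit _ _) (gad _)     = refl
        evaluated star      _           = refl
        evaluated (gad _)   _           = refl

    at-isGad : ∀ {E e a} → E ⊢ e ⇒ encodeRow a at 11 → E ⊢ isGadTm e ⇒ bool (isGad a) at 60
    at-isGad {a = a} p = at-subst (evaluated a) (raise (at-branch p (at-branch (at-hd p) at-nil at-true) at-nil))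
      where
      evaluated : ∀ a → branch (encodeRow a) (branch (head (encodeRow a)) nil (nil ∙ nil)) nil ≡ bool (isGad a)
      evaluated star      = refl
      evaluated (lit _ _) = refl
      evaluated (gad _)   = refl

    encodeGen : Row c × Row c → Tree
    encodeGen = encodePair encodeRow encodeRow

    at-gen : ∀ {E g γ a r b s} →
      (encodeRow b ∙ s) ∙ (encodeRow a ∙ r) ∙ (encodeGen g ∙ γ) ∙ E ⊢ genTm ⇒ bool (gen g a b) at genScale
    at-gen {E} {p , q} {γ} {a} {r} {b} {s} =
      raise-≤ (≤-genScale _ _) (at-and (at-compatible ⊢p ⊢q)
        (at-and (at-not (at-and (at-isGad ⊢a) (at-isGad ⊢b)))
          (at-or (at-and (at-covers ⊢a ⊢p) (at-covers ⊢b ⊢q))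
                 (at-and (at-covers ⊢a ⊢q) (at-covers ⊢b ⊢p)))))
      where
      E′ = (encodeRow b ∙ s) ∙ (encodeRow a ∙ r) ∙ (encodeGen (p , q) ∙ γ) ∙ E
      ⊢p : E′ ⊢ hd (hd (var 2)) ⇒ encodeRow p at 11
      ⊢p = const-at (spec refl ≤-refl)
      ⊢q : E′ ⊢ tl (hd (var 2)) ⇒ encodeRow q at 11
      ⊢q = const-at (spec refl ≤-refl)
      ⊢a : E′ ⊢ hd (var 1) ⇒ encodeRow a at 11
      ⊢a = const-at (spec refl (m≤m+n _ 4))
      ⊢b : E′ ⊢ hd (var 0) ⇒ encodeRow b at 11
      ⊢b = const-at (spec refl (m≤m+n _ 5))

  -- Enumerating the rows and writing out the subspace

  block : ∀ {c} → Fin c → List (Row c)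
  block i = lit i zero ∷ lit i (suc zero) ∷ lit i (suc (suc zero)) ∷ gad i ∷ []

  prependBlocks : ∀ {c} → List (Fin c) → List (Row c) → List (Row c)
  prependBlocks is rows = foldl (λ acc i → block i ++ acc) rows is

  allRows : ∀ c → List (Row c)
  allRows c = prependBlocks (allFin c) (star ∷ [])

  length-prependBlocks : ∀ {c} (is : List (Fin c)) rows →
                         length (prependBlocks is rows) ≡ length rows + 4 * length is
  length-prependBlocks []       rows = sym (+-identityʳ _)
  length-prependBlocks (i ∷ is) rows = trans (length-prependBlocks is _) (lemma (length rows) (length is))
    where
    lemma : ∀ x y → 4 + x + 4 * y ≡ x + 4 * suc y
    lemma = solve-∀

  length-allRows : ∀ c → length (allRows c) ≡ 1 + 4 * c
  length-allRows c = trans (length-prependBlocks (allFin c) (star ∷ []))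
    (cong (λ x → 1 + 4 * x) (length-tabulate {n = c} (λ i → i)))

  constTm : ℕ → Tm
  constTm zero    = nil
  constTm (suc m) = cons nil (constTm m)

  -- The accumulator pairs the number of clauses already read with the rows built so far: the index
  -- of a clause is not part of its encoding and has to be counted.
  blockTm : Tm
  blockTm = cons (cons nil index)
    (cons (literalTm (constTm 0) (var 0))
    (cons (literalTm (constTm 1) (tl (var 0)))
    (cons (literalTm (constTm 2) (tl (tl (var 0))))
    (cons (cons nil index) (tl (var 1))))))
    where
    index = hd (var 1)
    literalTm : Tm → Tm → Tm
    literalTm j ℓs = cons (cons j (hd ℓs)) index

  rowsTm : Tm
  rowsTm = tl (fold (tl (var 0)) (cons nil (cons nil nil)) blockTm)

  cellTm : ℕ → ℕ → ℕ → Tm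
  cellTm t c₀ c₁ = bind (var 4) (bind (var 3) (bind (var 2)
    (ite (entryTm t) (constTm c₁) (constTm c₀))))

  -- After the four binders the words of pairs are at index 0 and the words of rows at index 1. Each
  -- map pushes an element and an accumulator, so the words of rows reappear at 3 and 5. Mapping
  -- them to `nil` writes N in unary.
  mainTm : ℕ → ℕ → ℕ → Tm
  mainTm t c₀ c₁ = bind rowsTm (bind (cartesianTm 0 0) (bind (powersTm 1 t) (bind (powersTm 1 t)
    (cons (mapTm (var 1) nil) (mapTm (var 0) (mapTm (var 3) (mapTm (var 5) (cellTm t c₀ c₁))))))))

  constBound : ℕ → ℕ
  constBound zero    = 2
  constBound (suc m) = 2 + (4 + (constBound m + 8))

  -- 49 is 4 for the conjunction and 8 + 4 + 3 for each of the three binders that shorten column,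
  -- row and generator.
  entryScale : ℕ → ℕ
  entryScale zero    = 16
  entryScale (suc t) = entryScale t + (genScale + 49)

  cellBound : ℕ → ℕ → ℕ → ℕ → ℕ
  cellBound Q t c₀ c₁ = 7 + (4 + ((6 + (4 + ((5 + (4 +
    ((entryScale t * Q + (2 + (constBound c₁ + constBound c₀))) + 3))) + 3))) + 3))

  mainBound : (c s Q t c₀ c₁ : ℕ) → ℕ
  mainBound c s Q t c₀ c₁ =
    (foldBound 30 6 c 300 + 3) + (4 + ((cartesianBound 0 0 s s + (4 + ((powersBound 1 s t + (4 + ((powersBound 1 (s * s) t + (4 + (
      (foldBound 2 4 (s ^ t) 18 + (4 + (
        foldBound 2 3 ((s * s) ^ t) (foldBound 2 6 (s ^ t) (foldBound 2 8 (s ^ t)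
          (cellBound Q t c₀ c₁ + 16) + 16) + 16)
        + 8))) + 3))) + 3))) + 3))) + 3))

  ⊢const : ∀ {E} m → E ⊢ constTm m ⇒ encodeℕ m within constBound m
  ⊢const zero    = spec refl ≤-refl
  ⊢const (suc m) = ⊢cons (direct nil) (⊢const m)

  module Run {n} (φ : 3CNF n) where

    open 3CNF φ using (clauses)

    c : ℕ
    c = length clauses

    literals : Fin c → Fin 3 → Literal n
    literals i j = Vec.lookup (List.lookup clauses i) j

    open Design literals public
    open Tests literals

    encodeClause : Clause n → Tree
    encodeClause C = encodeList encodeLiteral (Vec.toList C)

    State : Set
    State = ℕ × List Tree

    encodeState : State → Tree
    encodeState (k , ts) = encodeℕ k ∙ encodeList (λ t → t) ts

    treeBlock : ℕ → Clause n → List Tree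
    treeBlock k (ℓ₀ ∷ ℓ₁ ∷ ℓ₂ ∷ []) =
      ((encodeℕ 0 ∙ encodeLiteral ℓ₀) ∙ encodeℕ k) ∷
      ((encodeℕ 1 ∙ encodeLiteral ℓ₁) ∙ encodeℕ k) ∷
      ((encodeℕ 2 ∙ encodeLiteral ℓ₂) ∙ encodeℕ k) ∷
      (nil ∙ encodeℕ k) ∷ []

    advance : Clause n → State → State
    advance C (k , ts) = suc k , treeBlock k C ++ ts

    ⊢advance : ∀ {E} C σ → encodeClause C ∙ encodeState σ ∙ E ⊢ blockTm ⇒ encodeState (advance C σ) within 300
    ⊢advance (ℓ₀ ∷ ℓ₁ ∷ ℓ₂ ∷ []) (k , ts) = weaken (≤ᵇ⇒≤ _ _ _) (direct blockTm)

    treeBlock-block : ∀ i → treeBlock (toℕ i) (List.lookup clauses i) ≡ List.map encodeRow (block i)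
    treeBlock-block i with List.lookup clauses i
    ... | ℓ₀ ∷ ℓ₁ ∷ ℓ₂ ∷ [] = refl

    -- The whole list is the case of the identity and k = 0; the shift `h` lets the induction pass
    -- to the remaining clauses while the counter advances.
    states : ∀ {m} (h : Fin m → Fin c) k rows → (∀ i → k + toℕ i ≡ toℕ (h i)) →
      foldl (λ σ C → advance C σ) (k , List.map encodeRow rows) (tabulate (λ i → List.lookup clauses (h i)))
      ≡ (k + m , List.map encodeRow (prependBlocks (tabulate h) rows))
    states {zero}  h k rows p = cong (_, List.map encodeRow rows) (sym (+-identityʳ k))
    states {suc m} h k rows p
      rewrite trans (cong (λ l → treeBlock l (List.lookup clauses (h zero))) (trans (sym (+-identityʳ k)) (p zero)))
                    (treeBlock-block (h zero)) =
      trans (states (λ i → h (suc i)) (suc k) (block (h zero) ++ rows)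
              (λ i → trans (sym (+-suc k (toℕ i))) (p (suc i))))
            (cong (_, List.map encodeRow (prependBlocks (tabulate h) rows)) (sym (+-suc k m)))

    encodeList-id : ∀ {a} {X : Set a} (enc : X → Tree) xs → encodeList (λ t → t) (List.map enc xs) ≡ encodeList enc xs
    encodeList-id enc xs = encode-map (λ t → t) enc xs

    ⊢rows : ∀ {cc} → c ≤ cc →
            encodeFormula φ ∙ nil ⊢ rowsTm ⇒ encodeList encodeRow (allRows c) within foldBound 30 6 cc 300 + 3
    ⊢rows len = ⊢subst
      (trans (cong (λ Cs → tail (encodeState (foldl (λ σ C → advance C σ) (0 , nil ∷ []) Cs))) (sym (tabulate-lookup clauses)))
      (trans (cong (λ σ → tail (encodeState σ)) (states (λ i → i) 0 (star ∷ []) (λ _ → refl)))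
             (encodeList-id encodeRow (allRows c))))
      (⊢tl (⊢fold encodeClause encodeState advance {xs = clauses} {B = 300} (spec refl ≤-refl) len
        (spec refl ≤-refl) ⊢advance))

    open Scaled Q (s≤s z≤n)

    encodeRows : ∀ {t} → Vec (Row c) t → Tree
    encodeRows = encodeVec encodeRow

    encodeGens : ∀ {t} → Vec (Row c × Row c) t → Tree
    encodeGens = encodeVec encodeGen

    entry-sum : ∀ g K → g + (2 + ((8 + (4 + ((8 + (4 + ((8 + (4 + (K + 3))) + 3))) + 3))) + 2)) ≡ K + (g + 49)
    entry-sum = solve-∀

    at-bind : ∀ {E e f v w k k′} → E ⊢ e ⇒ v at k → v ∙ E ⊢ f ⇒ w at k′ → E ⊢ bind e f ⇒ w at (k + (4 + (k′ + 3)))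
    at-bind {k = k} {k′} (at p) (at q) = at (weaken
      (add k (4 + (k′ + 3)) ≤-refl (add 4 (k′ + 3) (scale 4) (add k′ 3 ≤-refl (scale 3))))
      (⊢bind p q))

    at-entry : ∀ {t E} (γ : Vec (Row c × Row c) t) r s →
               encodeRows s ∙ encodeRows r ∙ encodeGens γ ∙ E ⊢ entryTm t ⇒ bool (entry γ r s) at entryScale t
    at-entry []      []      []      = at-true
    at-entry {suc t} (g ∷ γ) (a ∷ r) (b ∷ s) = at (weaken
      (*-monoˡ-≤ Q (≤-reflexive (entry-sum genScale (entryScale t))))
      (unscaled (at-and (at-gen {g = g}) (at-bind pop (at-bind pop (at-bind pop (at-entry γ r s)))))))
      where
      pop : ∀ {E} → E ⊢ tl (var 2) ⇒ tail (head (tail (tail E))) at 8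
      pop = const-at (spec refl ≤-refl)

    symbol : ℕ → ℕ → Bool → Tree
    symbol c₀ c₁ b = ifᵇ b then encodeℕ c₁ else encodeℕ c₀

    output : ℕ → ℕ → ℕ → Tree
    output t c₀ c₁ =
      encodeList (λ _ → nil) rs ∙
      encodeList (λ γ → encodeList (λ r → encodeList (λ s → symbol c₀ c₁ (entry γ r s)) rs) rs)
        (reverse (powers (cartesian (allRows c) (allRows c)) t))
      where rs = reverse (powers (allRows c) t)

    -- The running time has to be a function of n alone, so the number of clauses and the scale,
    -- which vary with the formula, give way to upper bounds.
    module _ {cc Qb : ℕ} (c≤cc : c ≤ cc) (Q≤Qb : Q ≤ Qb) (t c₀ c₁ : ℕ) where

      s : ℕ
      s = 1 + 4 * cc

      rows≤ : length (allRows c) ≤ s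
      rows≤ = ≤-trans (≤-reflexive (length-allRows c)) (s≤s (*-monoʳ-≤ 4 c≤cc))

      pairs≤ : length (cartesian (allRows c) (allRows c)) ≤ s * s
      pairs≤ = ≤-trans (≤-reflexive (length-cartesian (allRows c) (allRows c))) (*-mono-≤ rows≤ rows≤)

      powers≤ : ∀ {a} {X : Set a} (xs : List X) {l} → length xs ≤ l → length (powers xs t) ≤ l ^ t
      powers≤ xs p = ≤-trans (≤-reflexive (length-powers xs t)) (^-monoˡ-≤ t p)

      ⊢cell : ∀ {x₁ x₂ x₃ E} (γ : Vec (Row c × Row c) t) r v →
        encodeRows v ∙ x₁ ∙ encodeRows r ∙ x₂ ∙ encodeGens γ ∙ x₃ ∙ E ⊢ cellTm t c₀ c₁ ⇒
        symbol c₀ c₁ (entry γ r v) within cellBound Qb t c₀ c₁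
      ⊢cell γ r v = ⊢bind (direct (var 4)) (⊢bind (direct (var 3)) (⊢bind (direct (var 2))
        (⊢ite (entry γ r v) (weaken (*-monoʳ-≤ (entryScale t) Q≤Qb) (unscaled (at-entry γ r v)))
          (⊢const c₁) (⊢const c₀))))

      ⊢main : encodeFormula φ ∙ nil ⊢ mainTm t c₀ c₁ ⇒ output t c₀ c₁ within mainBound cc s Qb t c₀ c₁
      ⊢main = ⊢bind (⊢rows c≤cc)
        (⊢bind (⊢cartesian encodeRow encodeRow 0 0 {ys = allRows c} {s} {s} refl refl rows≤ rows≤)
        (⊢bind (⊢powers encodeRow 1 t {xs = allRows c} {s} refl rows≤)
        (⊢bind (⊢powers encodeGen 1 t {xs = cartesian (allRows c) (allRows c)} {s * s} refl pairs≤)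
        (⊢cons
          (⊢map encodeRows (λ _ → nil) {L = s ^ t} (spec refl ≤-refl) (powers≤ (allRows c) rows≤) (λ _ _ → direct nil))
          (⊢map encodeGens _ {L = (s * s) ^ t} (spec refl ≤-refl) (powers≤ _ pairs≤) (λ γ _ →
            ⊢map encodeRows _ {L = s ^ t} (spec refl ≤-refl) (powers≤ (allRows c) rows≤) (λ r _ →
              ⊢map encodeRows _ {L = s ^ t} (spec refl ≤-refl) (powers≤ (allRows c) rows≤) (λ v _ →
                ⊢cell γ r v))))))))

  -- Bounds of the form b ^ O(t)

  -- Used with b = 2 + n and t = ⌈log₂ (1 + k)⌉. The degree depends on neither, so one constant
  -- serves every k.
  record Polynomial (f : ℕ → ℕ → ℕ) : Set where
    constructor poly
    field
      degree  : ℕ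
      bounded : ∀ t b → 1 ≤ t → 2 ≤ b → f t b ≤ b ^ (degree * t)

  n≤2^n : ∀ n → n ≤ 2 ^ n
  n≤2^n n = <⇒≤ (n<2^n n)
    where
    n<2^n : ∀ n → n < 2 ^ n
    n<2^n zero    = s≤s z≤n
    n<2^n (suc n) = +-mono-≤ (m^n>0 2 n) (≤-trans (n<2^n n) (m≤m+n _ 0))

  module _ {b : ℕ} (2≤b : 2 ≤ b) where

    ^-mono : ∀ {m n} → m ≤ n → b ^ m ≤ b ^ n
    ^-mono = ^-monoʳ-≤ b {{>-nonZero (≤-trans (s≤s z≤n) 2≤b)}}

  poly-const : ∀ k → Polynomial (λ _ _ → k)
  poly-const k = poly k λ t b 1≤t 2≤b →
    ≤-trans (n≤2^n k) (≤-trans (^-monoˡ-≤ k 2≤b)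
      (^-mono 2≤b (m≤m*n k t {{>-nonZero 1≤t}})))

  poly-base : Polynomial (λ _ b → b)
  poly-base = poly 1 λ t b 1≤t 2≤b → ≤-trans (≤-reflexive (sym (^-identityʳ b)))
    (^-mono 2≤b (≤-trans 1≤t (m≤m+n t 0)))

  poly-exponent : Polynomial (λ t _ → t)
  poly-exponent = poly 1 λ t b 1≤t 2≤b → ≤-trans (n≤2^n t) (≤-trans (^-monoˡ-≤ t 2≤b)
    (^-mono 2≤b (m≤m+n t 0)))

  infixl 6 _⊞_
  infixl 7 _⊠_

  _⊞_ : ∀ {f g} → Polynomial f → Polynomial g → Polynomial (λ t b → f t b + g t b)
  -- The additional 1 in the degree pays for the factor 2, since 2 ≤ b and 1 ≤ t.
  poly d p ⊞ poly e q = poly (1 + (d + e)) λ t b 1≤t 2≤b → begin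
    _                            ≤⟨ +-mono-≤ (p t b 1≤t 2≤b) (q t b 1≤t 2≤b) ⟩
    b ^ (d * t) + b ^ (e * t)    ≤⟨ +-mono-≤ (^-mono 2≤b (*-monoˡ-≤ t (m≤m+n d e)))
                                             (^-mono 2≤b (*-monoˡ-≤ t (m≤n+m e d))) ⟩
    b ^ ((d + e) * t) + b ^ ((d + e) * t) ≡⟨ double (b ^ ((d + e) * t)) ⟩
    2 * b ^ ((d + e) * t)        ≤⟨ *-monoˡ-≤ _ 2≤b ⟩
    b ^ (1 + (d + e) * t)        ≤⟨ ^-mono 2≤b (+-monoˡ-≤ _ 1≤t) ⟩
    b ^ ((1 + (d + e)) * t)      ∎
    where
    open ≤-Reasoning
    double : ∀ x → x + x ≡ 2 * x
    double = solve-∀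

  _⊠_ : ∀ {f g} → Polynomial f → Polynomial g → Polynomial (λ t b → f t b * g t b)
  poly d p ⊠ poly e q = poly (d + e) λ t b 1≤t 2≤b → ≤-trans
    (*-mono-≤ (p t b 1≤t 2≤b) (q t b 1≤t 2≤b))
    (≤-reflexive (trans (sym (^-distribˡ-+-* b (d * t) (e * t))) (cong (b ^_) (sym (*-distribʳ-+ t d e)))))

  -- `f` is a function of b alone: a bound b ^ (d * t) raised to the power t would have t squared in
  -- its exponent.
  poly-^ : ∀ {f} → Polynomial (λ _ → f) → Polynomial (λ t b → f b ^ t)
  poly-^ (poly d p) = poly d λ t b 1≤t 2≤b → ≤-trans
    (^-monoˡ-≤ t (p 1 b ≤-refl 2≤b))
    (≤-reflexive (trans (^-*-assoc b (d * 1) t) (cong (λ x → b ^ (x * t)) (*-identityʳ d))))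

  poly-≤ : ∀ {f g} → (∀ t b → 2 ≤ b → f t b ≤ g t b) → Polynomial g → Polynomial f
  poly-≤ f≤g (poly d p) = poly d λ t b 1≤t 2≤b → ≤-trans (f≤g t b 2≤b) (p t b 1≤t 2≤b)

  poly-fold : ∀ {f g h k} → Polynomial f → Polynomial g → Polynomial h → Polynomial k →
              Polynomial (λ t b → foldBound (f t b) (g t b) (h t b) (k t b))
  poly-fold f g h k = f ⊞ (poly-const 4 ⊞ (g ⊞
    (h ⊠ (poly-const 2 ⊞ (poly-const 14 ⊞ (k ⊞ poly-const 18))) ⊞ poly-const 2 ⊞ poly-const 6)))

  poly-cartesian : ∀ {f g} i j → Polynomial f → Polynomial g →
                   Polynomial (λ t b → cartesianBound i j (f t b) (g t b))
  poly-cartesian i j f g = poly-fold (poly-const 2) (poly-const (varTime i)) f inner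
    where
    inner = poly-fold (poly-const 4) (poly-const (varTime (2 + j))) g (poly-const 36)

  foldBound-mono : ∀ Bi Bx {L L′ B B′} → L ≤ L′ → B ≤ B′ → foldBound Bi Bx L B ≤ foldBound Bi Bx L′ B′
  foldBound-mono Bi Bx L≤ B≤ = +-monoʳ-≤ Bi (+-monoʳ-≤ 4 (+-monoʳ-≤ Bx (+-monoˡ-≤ 6 (+-monoˡ-≤ 2
    (*-mono-≤ L≤ (+-monoʳ-≤ 16 (+-monoˡ-≤ 18 B≤)))))))

  -- Replaces the recursion by t copies of its largest, final step, a closed form to which the
  -- closure properties apply.
  powersBound-≤ : ∀ i s t → 1 ≤ s →
    powersBound i s t ≤ 16 + t * (4 + (cartesianBound (suc i) 0 s (s ^ t) + 3))
  powersBound-≤ i s zero    1≤s = ≤-refl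
  powersBound-≤ i s (suc t) 1≤s = begin
    powersBound i s t + step t        ≤⟨ +-monoˡ-≤ _ (powersBound-≤ i s t 1≤s) ⟩
    16 + t * step t + step t          ≡⟨ rearrange t (step t) ⟩
    16 + suc t * step t               ≤⟨ +-monoʳ-≤ 16 (*-monoʳ-≤ (suc t) step-mono) ⟩
    16 + suc t * step (suc t)         ∎
    where
    open ≤-Reasoning
    step : ℕ → ℕ
    step t = 4 + (cartesianBound (suc i) 0 s (s ^ t) + 3)
    rearrange : ∀ t x → 16 + t * x + x ≡ 16 + suc t * x
    rearrange = solve-∀
    step-mono : step t ≤ step (suc t)
    step-mono = +-monoʳ-≤ 4 (+-monoˡ-≤ 3 (foldBound-mono 2 (varTime (suc i)) (≤-refl {s})
      (foldBound-mono 4 5 (^-monoʳ-≤ s {{>-nonZero 1≤s}} (n≤1+n t)) (≤-refl {36}))))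

  poly-powers : ∀ {s} i → (∀ b → 2 ≤ b → 1 ≤ s b) → Polynomial (λ _ → s) →
                Polynomial (λ t b → powersBound i (s b) t)
  poly-powers {s} i 1≤s p = poly-≤ (λ t b 2≤b → powersBound-≤ i (s b) t (1≤s b 2≤b))
    (poly-const 16 ⊞ poly-exponent ⊠ (poly-const 4 ⊞ (poly-cartesian (suc i) 0 p (poly-^ p) ⊞ poly-const 3)))

  poly-entryScale : Polynomial (λ t _ → entryScale t)
  poly-entryScale = poly-≤ (λ t _ _ → ≤-reflexive (entryScale-≡ t))
    (poly-const 16 ⊞ poly-exponent ⊠ poly-const (genScale + 49))
    where
    rearrange : ∀ t x → 16 + t * x + x ≡ 16 + suc t * x
    rearrange = solve-∀
    entryScale-≡ : ∀ t → entryScale t ≡ 16 + t * (genScale + 49)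
    entryScale-≡ zero    = refl
    entryScale-≡ (suc t) = trans (cong (_+ (genScale + 49)) (entryScale-≡ t)) (rearrange t (genScale + 49))

  clauseBound rowBound scaleBound : ℕ → ℕ
  clauseBound b = b * 2 * (b * 2 * (b * 2))
  rowBound b    = 1 + 4 * clauseBound b
  scaleBound b  = 3 + (clauseBound b + b)

  totalBound : ℕ → ℕ → ℕ → ℕ → ℕ
  totalBound c₀ c₁ t b = 4 + mainBound (clauseBound b) (rowBound b) (scaleBound b) t c₀ c₁

  poly-clauseBound : Polynomial (λ _ → clauseBound)
  poly-clauseBound = p ⊠ (p ⊠ p)
    where p = poly-base ⊠ poly-const 2

  poly-rowBound : Polynomial (λ _ → rowBound)
  poly-rowBound = poly-const 1 ⊞ poly-const 4 ⊠ poly-clauseBound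

  poly-totalBound : ∀ c₀ c₁ → Polynomial (totalBound c₀ c₁)
  poly-totalBound c₀ c₁ = total
    where
    # = poly-const
    r = poly-rowBound
    q = # 3 ⊞ (poly-clauseBound ⊞ poly-base)
    cell = # 7 ⊞ (# 4 ⊞ ((# 6 ⊞ (# 4 ⊞ ((# 5 ⊞ (# 4 ⊞
      ((poly-entryScale ⊠ q ⊞ (# 2 ⊞ (# (constBound c₁) ⊞ # (constBound c₀)))) ⊞ # 3))) ⊞ # 3))) ⊞ # 3))
    total = # 4 ⊞ (
      (poly-fold (# 30) (# 6) poly-clauseBound (# 300) ⊞ # 3) ⊞ (# 4 ⊞ ((poly-cartesian 0 0 r r ⊞ (# 4 ⊞
      ((poly-powers 1 (λ _ _ → s≤s z≤n) r ⊞ (# 4 ⊞ ((poly-powers 1 (λ _ _ → s≤s z≤n) (r ⊠ r) ⊞ (# 4 ⊞ (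
        (poly-fold (# 2) (# 4) (poly-^ r) (# 18) ⊞ (# 4 ⊞ (
          poly-fold (# 2) (# 3) (poly-^ (r ⊠ r)) (poly-fold (# 2) (# 6) (poly-^ r)
            (poly-fold (# 2) (# 8) (poly-^ r) (cell ⊞ # 16) ⊞ # 16) ⊞ # 16)
          ⊞ # 8))) ⊞ # 3))) ⊞ # 3))) ⊞ # 3))) ⊞ # 3)))

  -- The number of clauses and the binary logarithm

  lookup-injective : ∀ {a} {X : Set a} {xs : List X} → Unique xs → ∀ i j →
                     List.lookup xs i ≡ List.lookup xs j → i ≡ j
  lookup-injective (x∉ ∷ u) zero    zero    eq = refl
  lookup-injective (x∉ ∷ u) zero    (suc j) eq = contradiction eq (All.lookup x∉ (∈-lookup j))
  lookup-injective (x∉ ∷ u) (suc i) zero    eq = contradiction (sym eq) (All.lookup x∉ (∈-lookup i))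
  lookup-injective (x∉ ∷ u) (suc i) (suc j) eq = cong suc (lookup-injective u i j eq)

  literalIndex : ∀ {n} → Literal n → Fin (n * 2)
  literalIndex (pos x) = combine x zero
  literalIndex (neg x) = combine x (suc zero)

  literalIndex-injective : ∀ {n} (ℓ ℓ′ : Literal n) → literalIndex ℓ ≡ literalIndex ℓ′ → ℓ ≡ ℓ′
  literalIndex-injective (pos x) (pos y) eq = cong pos (proj₁ (combine-injective x _ y _ eq))
  literalIndex-injective (neg x) (neg y) eq = cong neg (proj₁ (combine-injective x _ y _ eq))
  literalIndex-injective (pos x) (neg y) eq with () ← proj₂ (combine-injective x zero y (suc zero) eq)
  literalIndex-injective (neg x) (pos y) eq with () ← proj₂ (combine-injective x (suc zero) y zero eq)

  clauseCode : ∀ {n} → Clause n → Fin (n * 2 * (n * 2 * (n * 2)))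
  clauseCode (ℓ₀ ∷ ℓ₁ ∷ ℓ₂ ∷ []) = combine (literalIndex ℓ₀) (combine (literalIndex ℓ₁) (literalIndex ℓ₂))

  clauseCode-injective : ∀ {n} (C D : Clause n) → clauseCode C ≡ clauseCode D → C ≡ D
  clauseCode-injective (ℓ₀ ∷ ℓ₁ ∷ ℓ₂ ∷ []) (ℓ₀′ ∷ ℓ₁′ ∷ ℓ₂′ ∷ []) eq
    with eq₀ , eq′ ← combine-injective (literalIndex ℓ₀) _ (literalIndex ℓ₀′) _ eq
    with eq₁ , eq₂ ← combine-injective (literalIndex ℓ₁) (literalIndex ℓ₂) (literalIndex ℓ₁′) (literalIndex ℓ₂′) eq′
    = cong₂ _∷_ (literalIndex-injective _ _ eq₀) (cong₂ _∷_ (literalIndex-injective _ _ eq₁)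
        (cong (_∷ []) (literalIndex-injective _ _ eq₂)))

  clauses-≤ : ∀ {n} (φ : 3CNF n) → length (3CNF.clauses φ) ≤ clauseBound (2 + n)
  clauses-≤ {n} φ = ≤-trans
    (injective⇒≤ {f = λ i → clauseCode (List.lookup clauses i)}
      (λ {i} {j} eq → lookup-injective distinct i j (clauseCode-injective _ _ eq)))
    (*-mono-≤ n2≤ (*-mono-≤ n2≤ n2≤))
    where
    open 3CNF φ
    n2≤ : n * 2 ≤ (2 + n) * 2
    n2≤ = *-monoˡ-≤ 2 (m≤n+m n 2)

  0<⌈log₂⌉ : ∀ {n} → 2 ≤ n → 0 < ⌈log₂ n ⌉
  0<⌈log₂⌉ = ⌈log₂⌉-mono-≤

  -- At `suc k` this makes a triangle of size 2 ^ t too large for rank k.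
  n≤2^⌈log₂n⌉ : ∀ n → n ≤ 2 ^ ⌈log₂ n ⌉
  n≤2^⌈log₂n⌉ = <-rec _ step
    where
    open ≤-Reasoning
    step : ∀ n → (∀ {m} → m < n → m ≤ 2 ^ ⌈log₂ m ⌉) → n ≤ 2 ^ ⌈log₂ n ⌉
    step 0             rec = z≤n
    step 1             rec = s≤s z≤n
    step n@(suc (suc m)) rec = begin
      n                                ≡⟨ ⌊n/2⌋+⌈n/2⌉≡n n ⟨
      ⌊ n /2⌋ + ⌈ n /2⌉                ≤⟨ +-mono-≤ (⌊n/2⌋≤⌈n/2⌉ n) (m≤m+n ⌈ n /2⌉ 0) ⟩
      2 * ⌈ n /2⌉                      ≤⟨ *-monoʳ-≤ 2 (rec (⌈n/2⌉<n m)) ⟩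
      2 ^ suc ⌈log₂ ⌈ n /2⌉ ⌉          ≡⟨ cong (λ l → 2 ^ suc l) (⌈log₂⌈n/2⌉⌉≡⌈log₂n⌉∸1 n) ⟩
      2 ^ suc (⌈log₂ n ⌉ ∸ 1)          ≡⟨ cong (2 ^_) (m+[n∸m]≡n (0<⌈log₂⌉ {n} (s≤s (s≤s z≤n)))) ⟩
      2 ^ ⌈log₂ n ⌉                    ∎

-- Linear algebra over a finite field

module Field {c ℓ₁ ℓ₂ : Level} {q : ℕ} (F : FiniteField c ℓ₁ ℓ₂ q) where

  open LinearAlgebra F using (Matrix; NonZeroMatrix; columns; Span; HasDimension; HasRank; combination)
  open CommutativeRing (FiniteField.commutativeRing F) public
    hiding (_≉_; zero) renaming (refl to ≈-refl; sym to ≈-sym; trans to ≈-trans; reflexive to ≈-reflexive)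
  open Algebra.Properties.Ring (CommutativeRing.ring (FiniteField.commutativeRing F)) public
    using (-‿distribˡ-*)
  open Algebra.Properties.Semiring.Sum (CommutativeRing.semiring (FiniteField.commutativeRing F)) public
    using (sum; sum-cong-≋; sum-replicate-zero; sum-remove; ∑-distrib-+; *-distribˡ-sum; *-distribʳ-sum)
  open Inverse (FiniteField.enumeration F) public using (to; from; to-cong; from-cong; strictlyInverseʳ)
  module ≈-Reasoning = Relation.Binary.Reasoning.Setoid setoid

  infix 4 _≉_
  _≉_ : Carrier → Carrier → Set ℓ₁
  x ≉ y = ¬ x ≈ y

  to-injective : ∀ {x y} → to x ≡ to y → x ≈ y
  to-injective {x} {y} eq =
    ≈-trans (≈-sym (strictlyInverseʳ x)) (≈-trans (≈-reflexive (cong from eq)) (strictlyInverseʳ y))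

  _≈?_ : ∀ x y → Dec (x ≈ y)
  x ≈? y = map′ to-injective to-cong (to x Fin.≟ to y)

  ≈-stable : ∀ {x y} → ¬ ¬ x ≈ y → x ≈ y
  ≈-stable {x} {y} = decidable-stable (x ≈? y)

  -- The field axioms invert what is apart from zero, and x ≉ 0# is weaker constructively.
  -- Finiteness allows a search: if it fails, x is not apart from zero, hence equal to it by
  -- tightness.
  inverse : ∀ {x} → x ≉ 0# → ∃[ y ] y * x ≈ 1#
  inverse {x} x≉0 with any? (λ i → (from i * x) ≈? 1#)
  ... | yes (i , p) = from i , p
  ... | no  none    = contradiction (proj₁ (tight x 0#) not-apart) x≉0
    where
    open HeytingField (FiniteField.heytingField F) using (_#_; tight; #⇒invertible)
    x-0≈x : x - 0# ≈ x
    x-0≈x = ≈-trans (+-congˡ (≈-trans (≈-sym (+-identityˡ _)) (-‿inverseʳ 0#))) (+-identityʳ x)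
    not-apart : ¬ x # 0#
    not-apart x#0 with y , yx≈1 , _ ← #⇒invertible x#0 =
      none (to y , ≈-trans (*-cong (strictlyInverseʳ y) (≈-sym x-0≈x)) yx≈1)

  -- In the zero ring all elements are equal, but the enumeration separates two of them.
  1≉0 : 1 ℕ.< q → 1# ≉ 0#
  1≉0 (s≤s (s≤s _)) 1≈0 = contradiction
    (trans (sym (strictlyInverseˡ zero)) (trans (to-cong (all≈ _ _)) (strictlyInverseˡ (suc zero)))) λ ()
    where
    open Inverse (FiniteField.enumeration F) using (strictlyInverseˡ)
    ≈0 : ∀ x → x ≈ 0#
    ≈0 x = ≈-trans (≈-sym (*-identityʳ x)) (≈-trans (*-congˡ 1≈0) (zeroʳ x))
    all≈ : ∀ x y → x ≈ y
    all≈ x y = ≈-trans (≈0 x) (≈-sym (≈0 y))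

  skip : ∀ x y → 0# * x + y ≈ y
  skip x y = ≈-trans (+-congʳ (zeroˡ x)) (+-identityˡ y)

  sum-zero : ∀ {n} {f : Vector Carrier n} → (∀ i → f i ≈ 0#) → sum f ≈ 0#
  sum-zero {n} p = ≈-trans (sum-cong-≋ p) (sum-replicate-zero n)

  unit : ∀ {n} → Fin n → Vector Carrier n
  unit zero    zero    = 1#
  unit zero    (suc j) = 0#
  unit (suc i) zero    = 0#
  unit (suc i) (suc j) = unit i j

  sum-unit : ∀ {n} (i : Fin n) (f : Vector Carrier n) → sum (λ j → unit i j * f j) ≈ f i
  sum-unit zero    f = ≈-trans (+-cong (*-identityˡ _) (sum-zero (λ j → zeroˡ (f (suc j))))) (+-identityʳ _)
  sum-unit (suc i) f = ≈-trans (+-cong (zeroˡ _) (sum-unit i (λ j → f (suc j)))) (+-identityˡ _)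

  -- Pairs of a row and a column with nonzero entries on the diagonal and zero
  -- entries above it.
  Triangular : ∀ {a b} {X : Set a} {Y : Set b} → (X → Y → Carrier) → List (X × Y) → Set (a ⊔ b ⊔ ℓ₁)
  Triangular m []             = ⊤
  Triangular m ((x , y) ∷ ps) = m x y ≉ 0# × All (λ (x′ , y′) → m x y′ ≈ 0#) ps × Triangular m ps

  dot : ∀ {n} → Vector Carrier n → Vector Carrier n → Carrier
  dot f w = sum (λ l → f l * w l)

  -- One step of Gaussian elimination. Subtracting multiples of f preserves products with vectors
  -- orthogonal to f, as the later w are, and clears coordinate l, which can then be dropped.
  module Eliminate {n} (f : Vector Carrier (suc n)) (l : Fin (suc n)) {y} (yf≈1 : y * f l ≈ 1#) where

    pivot : Vector Carrier (suc n) → Vector Carrier (suc n)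
    pivot g m = g m + (- (g l * y)) * f m

    pivot-l : ∀ g → pivot g l ≈ 0#
    pivot-l g = begin
      g l + (- (g l * y)) * f l  ≈⟨ +-congˡ (≈-sym (-‿distribˡ-* (g l * y) (f l))) ⟩
      g l - g l * y * f l        ≈⟨ +-congˡ (-‿cong (≈-trans (*-assoc _ _ _) (*-congˡ yf≈1))) ⟩
      g l - g l * 1#             ≈⟨ +-congˡ (-‿cong (*-identityʳ _)) ⟩
      g l - g l                  ≈⟨ -‿inverseʳ _ ⟩
      0#                         ∎
      where open ≈-Reasoning

    reduce : Vector Carrier (suc n) × Vector Carrier (suc n) → Vector Carrier n × Vector Carrier n
    reduce (g , w) = removeAt (pivot g) l , removeAt w l

    dot-reduce : ∀ g w → dot f w ≈ 0# → dot (removeAt (pivot g) l) (removeAt w l) ≈ dot g w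
    dot-reduce g w fw≈0 = begin
      dot (removeAt (pivot g) l) (removeAt w l)     ≈⟨ +-identityˡ _ ⟨
      0# + dot (removeAt (pivot g) l) (removeAt w l)
        ≈⟨ +-congʳ (≈-trans (*-congʳ (pivot-l g)) (zeroˡ (w l))) ⟨
      pivot g l * w l + dot (removeAt (pivot g) l) (removeAt w l)
        ≈⟨ sum-remove {i = l} (λ m → pivot g m * w m) ⟨
      dot (pivot g) w
        ≈⟨ sum-cong-≋ (λ m → ≈-trans (distribʳ (w m) (g m) _) (+-congˡ (*-assoc (- (g l * y)) (f m) (w m)))) ⟩
      sum (λ m → g m * w m + (- (g l * y)) * (f m * w m))
        ≈⟨ ∑-distrib-+ (λ m → g m * w m) (λ m → (- (g l * y)) * (f m * w m)) ⟩
      dot g w + sum (λ m → (- (g l * y)) * (f m * w m))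
        ≈⟨ +-congˡ (*-distribˡ-sum (- (g l * y)) (λ m → f m * w m)) ⟨
      dot g w + (- (g l * y)) * dot f w             ≈⟨ +-congˡ (≈-trans (*-congˡ fw≈0) (zeroʳ _)) ⟩
      dot g w + 0#                                  ≈⟨ +-identityʳ _ ⟩
      dot g w                                       ∎
      where open ≈-Reasoning

    row-reduce : ∀ g {ps} → All (λ (_ , w) → dot f w ≈ 0#) ps → All (λ (_ , w) → dot g w ≈ 0#) ps →
                 All (λ (_ , w) → dot (removeAt (pivot g) l) w ≈ 0#) (List.map reduce ps)
    row-reduce g {[]}           []       []       = []
    row-reduce g {(_ , w) ∷ ps} (p ∷ ps≈0) (r ∷ rs) = ≈-trans (dot-reduce g w p) r ∷ row-reduce g ps≈0 rs

    triangular-reduce : ∀ {ps} → All (λ (_ , w) → dot f w ≈ 0#) ps → Triangular dot ps →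
                        Triangular dot (List.map reduce ps)
    triangular-reduce {[]}           []       _              = tt
    triangular-reduce {(g , w) ∷ ps} (p ∷ ps≈0) (gw≉0 , rs , t) =
      (λ e → gw≉0 (≈-trans (≈-sym (dot-reduce g w p)) e)) , row-reduce g ps≈0 rs , triangular-reduce ps≈0 t

  -- Induction on ρ: the leading f has a nonzero coordinate because its product with w is nonzero,
  -- and eliminating it uses up one pair and one dimension.
  triangular-dot : ∀ {ρ} (ps : List (Vector Carrier ρ × Vector Carrier ρ)) →
                   Triangular dot ps → length ps ℕ.≤ ρ
  triangular-dot         []             _  = z≤n
  triangular-dot {zero}  ((f , w) ∷ ps) (fw≉0 , _) = contradiction ≈-refl fw≉0
  triangular-dot {suc ρ} ((f , w) ∷ ps) (fw≉0 , ps≈0 , t) with any? (λ l → ¬? (f l ≈? 0#))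
  ... | no f≈0 = contradiction
        (sum-zero (λ l → ≈-trans (*-congʳ (≈-stable (λ fl≉0 → f≈0 (l , fl≉0)))) (zeroˡ (w l)))) fw≉0
  ... | yes (l , fl≉0) with y , yf≈1 ← inverse fl≉0 =
        s≤s (ℕ.≤-trans (ℕ.≤-reflexive (sym (length-map reduce ps)))
                     (triangular-dot (List.map reduce ps) (triangular-reduce ps≈0 t)))
    where open Eliminate f l yf≈1

  triangular-map : ∀ {a b a′ b′} {X : Set a} {Y : Set b} {X′ : Set a′} {Y′ : Set b′}
                   {m : X → Y → Carrier} {m′ : X′ → Y′ → Carrier} (g : X → X′) (h : Y → Y′) →
                   (∀ x y → m′ (g x) (h y) ≈ m x y) → ∀ ps → Triangular m ps →
                   Triangular m′ (List.map (λ (x , y) → g x , h y) ps)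
  triangular-map g h eq []             _ = tt
  triangular-map {m = m} {m′} g h eq ((x , y) ∷ ps) (p , rs , t) =
    (λ e → p (≈-trans (≈-sym (eq x y)) e)) , row ps rs , triangular-map g h eq ps t
    where
    row : ∀ ps → All (λ (_ , y′) → m x y′ ≈ 0#) ps →
          All (λ (_ , y′) → m′ (g x) y′ ≈ 0#) (List.map (λ (x , y) → g x , h y) ps)
    row []       []       = []
    row (_ ∷ ps) (r ∷ rs) = ≈-trans (eq x _) r ∷ row ps rs

  -- A basis of the column space factors M through dimension ρ: entry (i, j) is the product of the
  -- i-th coordinates of the basis vectors with the coefficients of column j.
  triangular-rank : ∀ {n ρ} (M : Matrix n n) → HasRank M ρ → ∀ ps → Triangular (λ i j → M (i , j)) ps →
                    length ps ℕ.≤ ρ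
  triangular-rank {n} {ρ} M rank ps t = ℕ.≤-trans (ℕ.≤-reflexive (sym (length-map _ ps)))
    (triangular-dot _ (triangular-map (λ i l → basis l i) (λ j → proj₁ (coordinates j)) entries ps t))
    where
    open HasDimension rank
    coordinates : ∀ j → Span basis (columns M j)
    coordinates j = spanning (columns M j) (unit j , λ i → ≈-sym (sum-unit j (λ l → M (i , l))))
    entries : ∀ i j → dot (λ l → basis l i) (proj₁ (coordinates j)) ≈ M (i , j)
    entries i j = ≈-trans (sum-cong-≋ (λ l → *-comm (basis l i) _)) (≈-sym (proj₂ (coordinates j) i))

  outer-rank : ∀ {n} (M : Matrix n n) (u : Vector Carrier n) o → u o ≈ 1# →
               (∀ i j → M (i , j) ≈ u i * u j) → HasRank M 1
  outer-rank M u o uo≈1 M≈ = record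
    { basis       = λ _ → u
    -- Column o of M is u itself, because u o is 1.
    ; inside      = λ _ → unit o , λ i → ≈-sym (≈-trans (sum-unit o (λ j → M (i , j)))
                      (≈-trans (M≈ i o) (≈-trans (*-congˡ uo≈1) (*-identityʳ _))))
    ; independent = λ { a eq zero → ≈-trans
                      (≈-sym (≈-trans (+-identityʳ _) (≈-trans (*-congˡ uo≈1) (*-identityʳ _)))) (eq o) }
    ; spanning    = λ v (a , eq) → (λ _ → sum (λ j → a j * u j)) , λ i → begin
        v i                            ≈⟨ eq i ⟩
        sum (λ j → a j * M (i , j))    ≈⟨ sum-cong-≋ (λ j → *-congˡ (≈-trans (M≈ i j) (*-comm _ _))) ⟩
        sum (λ j → a j * (u j * u i))  ≈⟨ sum-cong-≋ (λ j → ≈-sym (*-assoc (a j) _ _)) ⟩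
        sum (λ j → a j * u j * u i)    ≈⟨ *-distribʳ-sum (u i) (λ j → a j * u j) ⟨
        sum (λ j → a j * u j) * u i    ≈⟨ +-identityʳ _ ⟨
        sum (λ j → a j * u j) * u i + 0# ∎
    }
    where open ≈-Reasoning

-- Unsatisfiable formulas

∧-true : ∀ {x y} → x ∧ y ≡ true → x ≡ true × y ≡ true
∧-true {true} {true} refl = refl , refl

∨-true : ∀ {x y} → x ∨ y ≡ true → x ≡ true ⊎ y ≡ true
∨-true {true}  _ = inj₁ refl
∨-true {false} p = inj₂ p

==⇒≡ : ∀ {n} {i j : Fin n} → (i == j) ≡ true → i ≡ j
==⇒≡ p = toℕ-injective (ℕ.≡ᵇ⇒≡ _ _ (Equivalence.from T-≡ p))

==-refl : ∀ {n} (i : Fin n) → (i == i) ≡ true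
==-refl i = Equivalence.to T-≡ (ℕ.≡⇒≡ᵇ (toℕ i) (toℕ i) refl)

≡ᵇ-comm : ∀ m n → (m ≡ᵇ n) ≡ (n ≡ᵇ m)
≡ᵇ-comm zero    zero    = refl
≡ᵇ-comm zero    (suc n) = refl
≡ᵇ-comm (suc m) zero    = refl
≡ᵇ-comm (suc m) (suc n) = ≡ᵇ-comm m n

contradictory-comm : ∀ {n} (ℓ ℓ′ : Literal n) → contradictory ℓ ℓ′ ≡ contradictory ℓ′ ℓ
contradictory-comm (pos x) (pos y) = refl
contradictory-comm (pos x) (neg y) = ≡ᵇ-comm (toℕ x) (toℕ y)
contradictory-comm (neg x) (pos y) = ≡ᵇ-comm (toℕ x) (toℕ y)
contradictory-comm (neg x) (neg y) = refl

covers⇒≡ : ∀ {c} (b p : Row c) → isGad b ≡ false → covers b p ≡ true → p ≡ b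
covers⇒≡ star      star        _ _ = refl
covers⇒≡ (lit i j) (lit i′ j′) _ e with p , q ← ∧-true e = sym (cong₂ lit (==⇒≡ p) (==⇒≡ q))

module Generators {n c : ℕ} (L : Fin c → Fin 3 → Literal n) where

  open Design L public

  compatible-comm : ∀ a b → compatible a b ≡ compatible b a
  compatible-comm (lit i j) (lit i′ j′)
    rewrite ≡ᵇ-comm (toℕ i) (toℕ i′) | ≡ᵇ-comm (toℕ j) (toℕ j′)
          | contradictory-comm (L i j) (L i′ j′) = refl
  compatible-comm star      star      = refl
  compatible-comm star      (lit _ _) = refl
  compatible-comm star      (gad _)   = refl
  compatible-comm (lit _ _) star      = refl
  compatible-comm (lit _ _) (gad _)   = refl
  compatible-comm (gad _)   star      = refl
  compatible-comm (gad _)   (lit _ _) = refl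
  compatible-comm (gad _)   (gad _)   = refl

  gen-comm : ∀ g a b → gen g a b ≡ gen g b a
  gen-comm (p , q) a b = cong (compatible p q ∧_) (cong₂ _∧_ (cong not (∧-comm (isGad a) (isGad b)))
    (trans (∨-comm (covers a p ∧ covers b q) _)
           (cong₂ _∨_ (∧-comm (covers a q) _) (∧-comm (covers a p) _))))

  gen-gad : ∀ g i i′ → gen g (gad i) (gad i′) ≡ false
  gen-gad (p , q) i i′ = ∧-zeroʳ (compatible p q)

  -- Between coordinates a nonzero entry determines its generator up to order: it is (a , b) or (b ,
  -- a).
  gen-compatible : ∀ g a b → isGad a ≡ false → isGad b ≡ false → gen g a b ≡ true → compatible a b ≡ true
  gen-compatible (p , q) a b na nb e with pq , e′ ← ∧-true e with _ , e″ ← ∧-true e′ with ∨-true e″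
  ... | inj₁ f with ap , bq ← ∧-true f =
        subst (λ q → compatible a q ≡ true) (covers⇒≡ b q nb bq)
          (subst (λ p → compatible p q ≡ true) (covers⇒≡ a p na ap) pq)
  ... | inj₂ f with aq , bp ← ∧-true f = trans (compatible-comm a b)
        (subst (λ q → compatible b q ≡ true) (covers⇒≡ a q na aq)
          (subst (λ p → compatible p q ≡ true) (covers⇒≡ b p nb bp) pq))

  -- Column b of a generator is a column of `covers` or zero. Therefore the row `gad i` is a sum of
  -- other rows there, although `pairing` is built from a disjunction.
  pairing-cases : ∀ p q b → isGad b ≡ false →
    (∃[ r ] ∀ a → pairing (p , q) a b ≡ covers a r) ⊎ (∀ a → pairing (p , q) a b ≡ false)
  pairing-cases p q b nb with covers b p in bp | covers b q in bq
  ... | false | false = inj₂ λ a → none (covers a p) (covers a q)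
    where
    none : ∀ x y → x ∧ false ∨ y ∧ false ≡ false
    none false false = refl
    none false true  = refl
    none true  false = refl
    none true  true  = refl
  ... | false | true  = inj₁ (p , λ a → left (covers a p) (covers a q))
    where
    left : ∀ x y → x ∧ true ∨ y ∧ false ≡ x
    left false false = refl
    left false true  = refl
    left true  y     = refl
  ... | true  | false = inj₁ (q , λ a → right (covers a p) (covers a q))
    where
    right : ∀ x y → x ∧ false ∨ y ∧ true ≡ y
    right false false = refl
    right false true  = refl
    right true  false = refl
    right true  true  = refl
  ... | true  | true  = inj₁ (p , λ a → both (covers a p) (covers a q) (cong (covers a)
        (trans (covers⇒≡ b p nb bp) (sym (covers⇒≡ b q nb bq)))))
    where
    both : ∀ x y → x ≡ y → x ∧ true ∨ y ∧ true ≡ x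
    both true  true  refl = refl
    both false false refl = refl

module Weighted {c′ ℓ₁ ℓ₂ : Level} {q : ℕ} (F : FiniteField c′ ℓ₁ ℓ₂ q)
                {n c : ℕ} (L : Fin c → Fin 3 → Literal n) where

  open Field F
  open Generators L

  val : Bool → Carrier
  val true  = 1#
  val false = 0#

  val-∧ : ∀ x y → val (x ∧ y) ≈ val x * val y
  val-∧ true  y = ≈-sym (*-identityˡ _)
  val-∧ false y = ≈-sym (zeroˡ _)

  group : (Row c → Carrier) → Fin c → Carrier
  group f i = f star + (f (lit i zero) + (f (lit i (suc zero)) + f (lit i (suc (suc zero)))))

  group-cong : ∀ {f g} i → (∀ a → f a ≈ g a) → group f i ≈ group g i
  group-cong i eq = +-cong (eq star) (+-cong (eq _) (+-cong (eq _) (eq _)))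

  group-zero : ∀ {f} i → (∀ a → f a ≈ 0#) → group f i ≈ 0#
  group-zero i eq = ≈-trans (group-cong i eq) (≈-trans (+-identityˡ _) (≈-trans (+-identityˡ _) (+-identityˡ _)))

  covers-group : ∀ i p → val (covers (gad i) p) ≈ group (λ a → val (covers a p)) i
  covers-group i star = ≈-sym (≈-trans (+-congˡ (≈-trans (+-identityˡ _) (+-identityˡ _))) (+-identityʳ _))
  covers-group i (lit i′ j) with i == i′
  ... | false = ≈-sym (≈-trans (+-identityˡ _) (≈-trans (+-identityˡ _) (+-identityˡ _)))
  ... | true with j
  ...   | zero           = ≈-sym (≈-trans (+-identityˡ _) (≈-trans (+-congˡ (+-identityˡ _)) (+-identityʳ _)))
  ...   | suc zero       = ≈-sym (≈-trans (+-identityˡ _) (≈-trans (+-identityˡ _) (+-identityʳ _)))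
  ...   | suc (suc zero) = ≈-sym (≈-trans (+-identityˡ _) (≈-trans (+-identityˡ _) (+-identityˡ _)))
  covers-group i (gad _) = ≈-sym (≈-trans (+-identityˡ _) (≈-trans (+-identityˡ _) (+-identityˡ _)))

  gen-nongad : ∀ g a b → isGad b ≡ false → gen g a b ≡ compatible (proj₁ g) (proj₂ g) ∧ pairing g a b
  gen-nongad g a b nb rewrite nb | ∧-zeroʳ (isGad a) = refl

  gen-group : ∀ g i b → isGad b ≡ false → val (gen g (gad i) b) ≈ group (λ a → val (gen g a b)) i
  gen-group (p , q) i b nb = ≈-trans (≈-reflexive (cong val (gen-nongad (p , q) (gad i) b nb)))
    (≈-trans rest (group-cong i (λ a → ≈-reflexive (cong val (sym (gen-nongad (p , q) a b nb))))))
    where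
    rest : val (compatible p q ∧ pairing (p , q) (gad i) b) ≈
           group (λ a → val (compatible p q ∧ pairing (p , q) a b)) i
    rest with compatible p q | pairing-cases p q b nb
    ... | false | _             = ≈-sym (group-zero i (λ _ → ≈-refl))
    ... | true  | inj₂ none     = ≈-trans (≈-reflexive (cong val (none (gad i))))
                                    (≈-sym (group-zero i (λ a → ≈-reflexive (cong val (none a)))))
    ... | true  | inj₁ (r , eq) = ≈-trans (≈-reflexive (cong val (eq (gad i)))) (≈-trans (covers-group i r)
                                    (group-cong i (λ a → ≈-reflexive (cong val (sym (eq a))))))

  tensor : ∀ {t D} → Vector Carrier D → (Fin D → Vec (Row c × Row c) t) → Vec (Row c) t → Vec (Row c) t → Carrier
  tensor a γ r s = sum (λ l → a l * val (entry (γ l) r s))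

  HasTriangle : ∀ {t} → (Vec (Row c) t → Vec (Row c) t → Carrier) → ℕ → Set ℓ₁
  HasTriangle m k = ∃[ ps ] length ps ≡ k × Triangular m ps

  triangular-++ : ∀ {t} {m : Vec (Row c) t → Vec (Row c) t → Carrier} ps {ps′} →
    Triangular m ps → Triangular m ps′ →
    All (λ (x , _) → All (λ (_ , y) → m x y ≈ 0#) ps′) ps → Triangular m (ps ++ ps′)
  triangular-++ []       _             u _        = u
  triangular-++ (_ ∷ ps) (p , rs , t) u (z ∷ zs) = p , All.++⁺ rs z , triangular-++ ps t u zs

  Covered : Set
  Covered = ∃[ α ] ∀ i → ∃[ j ] literalValue α (L i j) ≡ true

  -- The induction step in contrapositive form: a block whose triangle would complete a larger one
  -- has no triangle and is zero by `ih`. No triangle has to be searched for. `ih` admits all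
  -- coefficients, since each block is a new combination of the tails of the same words.
  module Step (unsatisfiable : ¬ Covered) {t D} (a : Vector Carrier D) (γ : Fin D → Vec (Row c × Row c) (suc t))
    (ih : ∀ b → ¬ HasTriangle (tensor b (λ l → Vec.tail (γ l))) (2 ^ t) →
          ∀ r s → tensor b (λ l → Vec.tail (γ l)) r s ≈ 0#)
    (no-triangle : ¬ HasTriangle (tensor a γ) (2 ^ suc t)) where

    weighted : (Fin D → Carrier) → Vec (Row c) t → Vec (Row c) t → Carrier
    weighted f = tensor (λ l → a l * f l) (λ l → Vec.tail (γ l))

    slice : Row c → Row c → Vec (Row c) t → Vec (Row c) t → Carrier
    slice p q = weighted (λ l → val (gen (Vec.head (γ l)) p q))

    slice-entry : ∀ p q r s → tensor a γ (p ∷ r) (q ∷ s) ≈ slice p q r s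
    slice-entry p q r s = sum-cong-≋ (λ l → ≈-trans (*-congˡ (unfold (γ l))) (≈-sym (*-assoc (a l) _ _)))
      where
      unfold : ∀ γ → val (entry γ (p ∷ r) (q ∷ s)) ≈ val (gen (Vec.head γ) p q) * val (entry (Vec.tail γ) r s)
      unfold (g ∷ γ) = val-∧ (gen g p q) (entry γ r s)

    weighted-cong : ∀ {f g} → (∀ l → f l ≈ g l) → ∀ r s → weighted f r s ≈ weighted g r s
    weighted-cong eq r s = sum-cong-≋ (λ l → *-congʳ (*-congˡ (eq l)))

    weighted-+ : ∀ f g r s → weighted (λ l → f l + g l) r s ≈ weighted f r s + weighted g r s
    weighted-+ f g r s = ≈-trans
      (sum-cong-≋ (λ l → ≈-trans (*-congʳ (distribˡ (a l) (f l) (g l))) (distribʳ _ _ _)))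
      (∑-distrib-+ (λ l → a l * f l * val (entry (Vec.tail (γ l)) r s))
                   (λ l → a l * g l * val (entry (Vec.tail (γ l)) r s)))

    weighted-zero : ∀ {f} → (∀ l → f l ≈ 0#) → ∀ r s → weighted f r s ≈ 0#
    weighted-zero {f} eq r s = sum-zero {f = λ l → a l * f l * val (entry (Vec.tail (γ l)) r s)}
      (λ l → ≈-trans (*-congʳ (≈-trans (*-congˡ (eq l)) (zeroʳ _))) (zeroˡ _))

    Zero : Row c → Row c → Set ℓ₁
    Zero p q = ∀ r s → slice p q r s ≈ 0#

    slice-comm : ∀ p q r s → slice p q r s ≈ slice q p r s
    slice-comm p q = weighted-cong (λ l → ≈-reflexive (cong val (gen-comm (Vec.head (γ l)) p q)))

    slice-gad : ∀ i i′ → Zero (gad i) (gad i′)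
    slice-gad i i′ = weighted-zero (λ l → ≈-reflexive (cong val (gen-gad (Vec.head (γ l)) i i′)))

    slice-incompatible : ∀ p q → isGad p ≡ false → isGad q ≡ false → compatible p q ≡ false → Zero p q
    slice-incompatible p q np nq e = weighted-zero (λ l → zero-val (Vec.head (γ l)))
      where
      zero-val : ∀ g → val (gen g p q) ≈ 0#
      zero-val g with gen g p q in eq
      ... | false = ≈-refl
      ... | true with () ← trans (sym e) (gen-compatible g p q np nq eq)

    slice-group : ∀ i b → isGad b ≡ false → ∀ r s → slice (gad i) b r s ≈ group (λ a → slice a b r s) i
    slice-group i b nb r s = ≈-trans (weighted-cong (λ l → gen-group (Vec.head (γ l)) i b nb) r s)
      (≈-trans (weighted-+ _ _ r s) (+-congˡ (≈-trans (weighted-+ _ _ r s) (+-congˡ (weighted-+ _ _ r s)))))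

    -- The triangles are placed along the diagonal; only the block (p₁, q₂) lies above it, and (p₂,
    -- q₁) may be anything.
    two-blocks : ∀ p₁ q₁ p₂ q₂ → HasTriangle (slice p₁ q₁) (2 ^ t) → HasTriangle (slice p₂ q₂) (2 ^ t) →
                 ¬ Zero p₁ q₂
    two-blocks p₁ q₁ p₂ q₂ (ps , len , u) (ps′ , len′ , u′) z = no-triangle
      ( List.map (λ (x , y) → p₁ ∷ x , q₁ ∷ y) ps ++ List.map (λ (x , y) → p₂ ∷ x , q₂ ∷ y) ps′
      , trans (length-++ (List.map _ ps)) (cong₂ ℕ._+_ (trans (length-map _ ps) len)
          (trans (length-map _ ps′) (trans len′ (sym (ℕ.+-identityʳ _)))))
      , triangular-++ _ (triangular-map (p₁ ∷_) (q₁ ∷_) (slice-entry p₁ q₁) ps u)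
          (triangular-map (p₂ ∷_) (q₂ ∷_) (slice-entry p₂ q₂) ps′ u′)
          (All.map⁺ (All.universal (λ _ → All.map⁺ (All.universal (λ _ →
            ≈-trans (slice-entry p₁ q₂ _ _) (z _ _)) ps′)) ps)))

    -- Rows p, q against columns q, p: by symmetry both diagonal blocks of this pattern are the
    -- block (p, q), and the corner above them is (p, p).
    zero-row : ∀ p q → Zero p p → Zero p q
    zero-row p q z = ih _ λ tri@(ps , len , u) → two-blocks p q q p tri
      (List.map (λ (x , y) → x , y) ps , trans (length-map _ ps) len ,
        triangular-map (λ x → x) (λ y → y) (slice-comm q p) ps u) z

    -- Here the pattern has (p, p) and (q, q) on its diagonal. The support of the diagonal is thus
    -- pairwise compatible, and an assignment can be read off from it.
    compatible-support : ∀ p q → ¬ Zero p p → ¬ Zero q q → ¬ Zero p q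
    compatible-support p q ¬zp ¬zq z =
      ¬zp (ih _ λ tri → ¬zq (ih _ λ tri′ → two-blocks p p q q tri tri′ z))

    same-clause : ∀ i j j′ → (j == j′) ≡ false → Zero (lit i j) (lit i j′)
    same-clause i j j′ e = slice-incompatible (lit i j) (lit i j′) refl refl
      (trans (cong (ifᵇ_then j == j′ else not (contradictory (L i j) (L i j′))) (==-refl i)) e)

    gad-row : ∀ i b → Zero (gad i) b
    gad-row i b = zero-row (gad i) b (slice-gad i i)

    group-slices : ∀ i b → isGad b ≡ false → ∀ r s → group (λ a → slice a b r s) i ≈ 0#
    group-slices i b nb r s = ≈-trans (≈-sym (slice-group i b nb r s)) (gad-row i b r s)

    -- If all three literal rows vanished, equation i at column `star` would leave the block of
    -- `star` alone on its left side.
    some-literal : ¬ Zero star star → ∀ i → ¬ (∀ j → Zero (lit i j) (lit i j))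
    some-literal ¬zs i zs = ¬zs λ r s → begin
      slice star star r s  ≈⟨ +-identityʳ _ ⟨
      slice star star r s + 0#
        ≈⟨ +-congˡ (≈-trans (+-cong (z zero r s) (+-cong (z (suc zero) r s) (z (suc (suc zero)) r s)))
                            (≈-trans (+-identityˡ _) (+-identityˡ _))) ⟨
      group (λ a → slice a star r s) i  ≈⟨ group-slices i star refl r s ⟩
      0#                   ∎
      where
      open ≈-Reasoning
      z : ∀ j → Zero (lit i j) star
      z j = zero-row (lit i j) star (zs j)

    -- Otherwise `α` makes x true exactly if a row with nonzero diagonal block carries `pos x`. A
    -- row with nonzero diagonal block carrying `neg x` is satisfied too, because the two would be
    -- incompatible.
    star-zero : (∀ p → Dec (Zero p p)) → Zero star star
    star-zero dec with dec star
    ... | yes z = z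
    ... | no ¬zs = contradiction (α , λ i → satisfied i (Fin.¬∀⟶∃¬ 3 _ (λ j → dec (lit i j)) (some-literal ¬zs i))) unsatisfiable
      where
      chosen? : ∀ x → Dec (∃[ i ] ∃[ j ] (L i j ≡ pos x × ¬ Zero (lit i j) (lit i j)))
      chosen? x = any? λ i → any? λ j → isPos (L i j) ×-dec ¬? (dec (lit i j))
        where
        isPos : ∀ ℓ → Dec (ℓ ≡ pos x)
        isPos (pos y) with y Fin.≟ x
        ... | yes refl = yes refl
        ... | no y≢x   = no λ { refl → y≢x refl }
        isPos (neg y) = no λ ()
      α : Fin n → Bool
      α x = does (chosen? x)
      satisfied : ∀ i → ∃[ j ] ¬ Zero (lit i j) (lit i j) → ∃[ j ] literalValue α (L i j) ≡ true
      satisfied i (j , nz) = j , value (L i j) refl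
        where
        value : ∀ ℓ → L i j ≡ ℓ → literalValue α ℓ ≡ true
        value (pos x) eq with chosen? x
        ... | yes _ = refl
        ... | no none = contradiction (i , j , eq , nz) none
        value (neg x) eq with chosen? x
        ... | no _ = refl
        ... | yes (i′ , j′ , eq′ , nz′) = contradiction
              (slice-incompatible (lit i j) (lit i′ j′) refl refl incompatible)
              (compatible-support (lit i j) (lit i′ j′) nz nz′)
          where
          incompatible : compatible (lit i j) (lit i′ j′) ≡ false
          incompatible rewrite eq | eq′ | ==-refl x with i == i′ in ii | j == j′ in jj
          ... | false | _     = refl
          ... | true  | false = refl
          ... | true  | true  = contradiction
                (trans (sym eq) (trans (cong₂ L (==⇒≡ {i = i} {i′} ii) (==⇒≡ {i = j} {j′} jj)) eq′)) λ ()

    -- Equation i at column `lit i j`: the row of `star` is zero and the other two positions of the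
    -- clause are incompatible with j, so the diagonal block is all that remains.
    lit-zero : Zero star star → ∀ i j → Zero (lit i j) (lit i j)
    lit-zero zs i j r s = ≈-trans (≈-sym (select j)) (group-slices i (lit i j) refl r s)
      where
      star-row : ∀ j′ → slice star (lit i j′) r s ≈ 0#
      star-row j′ = zero-row star (lit i j′) zs r s
      select : ∀ j′ → group (λ a → slice a (lit i j′) r s) i ≈ slice (lit i j′) (lit i j′) r s
      select zero = ≈-trans (+-cong (star-row zero)
        (+-congˡ (≈-trans (+-cong (same-clause i (suc zero) zero refl r s) (same-clause i (suc (suc zero)) zero refl r s)) (+-identityˡ _))))
        (≈-trans (+-identityˡ _) (+-identityʳ _))
      select (suc zero) = ≈-trans (+-cong (star-row (suc zero))
        (+-cong (same-clause i zero (suc zero) refl r s) (+-congˡ (same-clause i (suc (suc zero)) (suc zero) refl r s))))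
        (≈-trans (+-identityˡ _) (≈-trans (+-identityˡ _) (+-identityʳ _)))
      select (suc (suc zero)) = ≈-trans (+-cong (star-row (suc (suc zero)))
        (+-cong (same-clause i zero (suc (suc zero)) refl r s) (+-congʳ (same-clause i (suc zero) (suc (suc zero)) refl r s))))
        (≈-trans (+-identityˡ _) (≈-trans (+-identityˡ _) (+-identityˡ _)))

    diagonal-zero : Zero star star → ∀ p → Zero p p
    diagonal-zero zs star      = zs
    diagonal-zero zs (lit i j) = lit-zero zs i j
    diagonal-zero zs (gad i)   = slice-gad i i

  module _ {xs : List (Row c)} (complete : ∀ p → p ∈ xs) where

    all-rows? : ∀ t {p} {P : Vec (Row c) t → Set p} → (∀ r → Dec (P r)) → Dec (∀ r → P r)
    all-rows? zero    P? with P? []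
    ... | yes p = yes λ { [] → p }
    ... | no ¬p = no λ ps → ¬p (ps [])
    all-rows? (suc t) P? with All.all? (λ p → all-rows? t (λ r → P? (p ∷ r))) xs
    ... | yes ps = yes λ { (p ∷ r) → All.lookup ps (complete p) r }
    ... | no ¬ps = no λ ps → ¬ps (All.universal (λ p r → ps (p ∷ r)) xs)

    vanishing : ¬ Covered → ∀ t {D} (a : Vector Carrier D) γ → ¬ HasTriangle (tensor a γ) (2 ^ t) →
                ∀ r s → tensor {t} a γ r s ≈ 0#
    -- For t = 0 a nonzero entry is itself a triangle of size 2 ^ 0.
    vanishing unsat zero a γ no-triangle [] [] =
      ≈-stable λ ne → no-triangle (([] , []) ∷ [] , refl , ne , [] , tt)
    vanishing unsat (suc t) a γ no-triangle (p ∷ r) (q ∷ s) =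
      ≈-trans (slice-entry p q r s) (zero-row p q (diagonal-zero (star-zero zero?) p) r s)
      where
      open Step unsat a γ (λ b → vanishing unsat t b (λ l → Vec.tail (γ l))) no-triangle
      zero? : ∀ p → Dec (Zero p p)
      zero? p = all-rows? t λ r → all-rows? t λ s → slice p p r s ≈? 0#

-- Satisfiable formulas

foldl-keeps : ∀ {a b} {X : Set a} {Y : Set b} {y : Y} {step : List Y → X → List Y} →
              (∀ x {acc} → y ∈ acc → y ∈ step acc x) → ∀ xs {acc} → y ∈ acc → y ∈ foldl step acc xs
foldl-keeps keep []       y∈ = y∈
foldl-keeps keep (x ∷ xs) y∈ = foldl-keeps keep xs (keep x y∈)

foldl-adds : ∀ {a b} {X : Set a} {Y : Set b} {y : Y} {step : List Y → X → List Y} →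
             (∀ x {acc} → y ∈ acc → y ∈ step acc x) → ∀ {x xs acc} → x ∈ xs →
             (∀ {acc} → y ∈ step acc x) → y ∈ foldl step acc xs
foldl-adds keep {xs = x ∷ xs} (here refl) add = foldl-keeps keep xs add
foldl-adds keep {xs = x ∷ xs} (there x∈)  add = foldl-adds keep x∈ add

∈-cartesian : ∀ {a b} {X : Set a} {Y : Set b} {x : X} {y : Y} {xs ys} →
              x ∈ xs → y ∈ ys → (x , y) ∈ cartesian xs ys
∈-cartesian {ys = ys} x∈ y∈ = foldl-adds (λ _ → foldl-keeps (λ _ → there) ys) x∈
  (foldl-adds (λ _ → there) y∈ (here refl))

∈-powers : ∀ {a} {X : Set a} {xs : List X} → (∀ x → x ∈ xs) → ∀ {t} (v : Vec X t) → v ∈ powers xs t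
∈-powers all []      = here refl
∈-powers all (x ∷ v) = ∈-map⁺ _ (∈-cartesian (all x) (∈-powers all v))

∈-allRows : ∀ {c} (a : Row c) → a ∈ allRows c
∈-allRows {c} star      = foldl-keeps (λ i {acc} → ∈-++⁺ʳ (block i) {acc}) (allFin c) (here refl)
∈-allRows     (lit i j) = foldl-adds (λ i {acc} → ∈-++⁺ʳ (block i) {acc}) (∈-allFin i) (∈-++⁺ˡ (lit∈ j))
  where
  lit∈ : ∀ j → lit i j ∈ block i
  lit∈ zero             = here refl
  lit∈ (suc zero)       = there (here refl)
  lit∈ (suc (suc zero)) = there (there (here refl))
∈-allRows     (gad i)   = foldl-adds (λ i {acc} → ∈-++⁺ʳ (block i) {acc}) (∈-allFin i)
  (∈-++⁺ˡ {xs = block i} (there (there (there (here refl)))))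

module Sums {c′ ℓ₁ ℓ₂ : Level} {q : ℕ} (F : FiniteField c′ ℓ₁ ℓ₂ q) where

  open Field F

  ∑ : ∀ {a} {X : Set a} → List X → (X → Carrier) → Carrier
  ∑ xs f = sum (λ l → f (List.lookup xs l))

  ∑-cong : ∀ {a} {X : Set a} xs {f g : X → Carrier} → (∀ x → f x ≈ g x) → ∑ xs f ≈ ∑ xs g
  ∑-cong xs eq = sum-cong-≋ (λ l → eq (List.lookup xs l))

  ∑-zero : ∀ {a} {X : Set a} xs {f : X → Carrier} → (∀ x → f x ≈ 0#) → ∑ xs f ≈ 0#
  ∑-zero xs {f} eq = sum-zero {f = λ l → f (List.lookup xs l)} (λ l → eq (List.lookup xs l))

  ∑-+ : ∀ {a} {X : Set a} xs (f g : X → Carrier) → ∑ xs (λ x → f x + g x) ≈ ∑ xs f + ∑ xs g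
  ∑-+ xs f g = ∑-distrib-+ (λ l → f (List.lookup xs l)) (λ l → g (List.lookup xs l))

  ∑-*ˡ : ∀ {a} {X : Set a} xs k (f : X → Carrier) → ∑ xs (λ x → k * f x) ≈ k * ∑ xs f
  ∑-*ˡ xs k f = ≈-sym (*-distribˡ-sum k (λ l → f (List.lookup xs l)))

  ∑-*ʳ : ∀ {a} {X : Set a} xs k (f : X → Carrier) → ∑ xs (λ x → f x * k) ≈ ∑ xs f * k
  ∑-*ʳ xs k f = ≈-sym (*-distribʳ-sum k (λ l → f (List.lookup xs l)))

  ∑-map : ∀ {a b} {X : Set a} {Y : Set b} (h : X → Y) xs (f : Y → Carrier) →
          ∑ (List.map h xs) f ≈ ∑ xs (λ x → f (h x))
  ∑-map h []       f = ≈-refl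
  ∑-map h (x ∷ xs) f = +-congˡ (∑-map h xs f)

  ∑-tabulate : ∀ {a} {X : Set a} {n} (h : Fin n → X) (f : X → Carrier) →
               ∑ (tabulate h) f ≈ sum (λ i → f (h i))
  ∑-tabulate {n = zero}  h f = ≈-refl
  ∑-tabulate {n = suc n} h f = +-congˡ (∑-tabulate (λ i → h (suc i)) f)

  ∑-foldl : ∀ {a b} {X : Set a} {Y : Set b} {step : List Y → X → List Y} {f : Y → Carrier} {g : X → Carrier} →
            (∀ x acc → ∑ (step acc x) f ≈ g x + ∑ acc f) →
            ∀ xs acc → ∑ (foldl step acc xs) f ≈ ∑ xs g + ∑ acc f
  ∑-foldl eq []       acc = ≈-sym (+-identityˡ _)
  ∑-foldl {step = step} {f} {g} eq (x ∷ xs) acc = begin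
    ∑ (foldl step (step acc x) xs) f ≈⟨ ∑-foldl {f = f} {g} eq xs (step acc x) ⟩
    ∑ xs g + ∑ (step acc x) f        ≈⟨ +-congˡ (eq x acc) ⟩
    ∑ xs g + (g x + ∑ acc f)         ≈⟨ +-assoc _ _ _ ⟨
    ∑ xs g + g x + ∑ acc f           ≈⟨ +-congʳ (+-comm _ _) ⟩
    g x + ∑ xs g + ∑ acc f           ∎
    where open ≈-Reasoning

  ∑-reverse : ∀ {a} {X : Set a} xs (f : X → Carrier) → ∑ (reverse xs) f ≈ ∑ xs f
  ∑-reverse xs f = ≈-trans (∑-foldl {f = f} {g = f} (λ x acc → ≈-refl) xs []) (+-identityʳ _)

  ∑-cartesian : ∀ {a b} {X : Set a} {Y : Set b} xs ys (f : X × Y → Carrier) →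
                ∑ (cartesian xs ys) f ≈ ∑ xs (λ x → ∑ ys (λ y → f (x , y)))
  ∑-cartesian xs ys f = ≈-trans
    (∑-foldl {f = f} {g = λ x → ∑ ys (λ y → f (x , y))}
      (λ x → ∑-foldl {f = f} {g = λ y → f (x , y)} (λ y acc → ≈-refl) ys) xs [])
    (+-identityʳ _)

  ∑-powers : ∀ {a} {X : Set a} (xs : List X) t {f : X → Carrier} {g : Vec X t → Carrier} {h : Vec X (suc t) → Carrier} →
             (∀ x v → h (x ∷ v) ≈ f x * g v) → ∑ (powers xs (suc t)) h ≈ ∑ xs f * ∑ (powers xs t) g
  ∑-powers xs t {f} {g} {h} eq = begin
    ∑ (powers xs (suc t)) h                                     ≈⟨ ∑-map _ (cartesian xs (powers xs t)) h ⟩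
    ∑ (cartesian xs (powers xs t)) (λ (x , v) → h (x ∷ v))      ≈⟨ ∑-cartesian xs (powers xs t) (λ (x , v) → h (x ∷ v)) ⟩
    ∑ xs (λ x → ∑ (powers xs t) (λ v → h (x ∷ v)))
      ≈⟨ ∑-cong xs (λ x → ≈-trans (∑-cong (powers xs t) (eq x)) (∑-*ˡ (powers xs t) (f x) g)) ⟩
    ∑ xs (λ x → f x * ∑ (powers xs t) g)                        ≈⟨ ∑-*ʳ xs _ f ⟩
    ∑ xs f * ∑ (powers xs t) g                                  ∎
    where open ≈-Reasoning

module Completeness {c′ ℓ₁ ℓ₂ : Level} {q : ℕ} (F : FiniteField c′ ℓ₁ ℓ₂ q)
                    {n c : ℕ} (L : Fin c → Fin 3 → Literal n)
                    (α : Assignment n) (choice : Fin c → Fin 3)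
                    (chosen-true : ∀ i → literalValue α (L i (choice i)) ≡ true) where

  open Field F
  open Sums F
  open Generators L
  open Weighted F L

  z : Row c → Carrier
  z star      = 1#
  z (lit i j) = ifᵇ choice i == j then - 1# else 0#
  z (gad _)   = 0#

  Z : ∀ {t} → Vec (Row c) t → Carrier
  Z []      = 1#
  Z (a ∷ r) = z a * Z r

  -- (p , q) and (q , p) give the same matrix, and weighting both with z p * z q would count it
  -- twice. Two literals of one clause precede each other, which is harmless: at distinct positions
  -- they are not both chosen, so their product is zero.
  precedes : Row c → Row c → Bool
  precedes (lit i _) (lit i′ _) = toℕ i ≤ᵇ toℕ i′
  precedes (lit _ _) _          = false
  precedes _         _          = true

  weight : Row c × Row c → Carrier
  weight (p , q) = ifᵇ precedes p q then z p * z q else 0#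

  Weight : ∀ {t} → Vec (Row c × Row c) t → Carrier
  Weight []      = 1#
  Weight (g ∷ γ) = weight g * Weight γ

  indicator-unit : ∀ {m} (i i′ : Fin m) → val (i == i′) ≡ unit i i′
  indicator-unit zero    zero     = refl
  indicator-unit zero    (suc i′) = refl
  indicator-unit (suc i) zero     = refl
  indicator-unit (suc i) (suc i′) = indicator-unit i i′

  ∑-block : ∀ (f : Row c → Carrier) → Fin c → Carrier
  ∑-block f i = ∑ (block i) f

  ∑-allRows : (f : Row c → Carrier) → ∑ (allRows c) f ≈ sum (∑-block f) + f star
  ∑-allRows f = ≈-trans
    (∑-foldl {f = f} {g = ∑-block f} prepend (allFin c) (star ∷ []))
    (+-cong (∑-tabulate (λ i → i) (∑-block f)) (+-identityʳ _))
    where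
    prepend : ∀ i acc → ∑ (block i ++ acc) f ≈ ∑-block f i + ∑ acc f
    prepend i acc = ≈-sym (≈-trans (+-assoc _ _ _) (+-congˡ (≈-trans (+-assoc _ _ _) (+-congˡ
      (≈-trans (+-assoc _ _ _) (+-congˡ (≈-trans (+-assoc _ _ _) (+-congˡ (+-identityˡ _)))))))))

  ∑-covers : ∀ b → isGad b ≡ false → (f : Row c → Carrier) → ∑ (allRows c) (λ p → val (covers b p) * f p) ≈ f b
  ∑-covers star refl f = ≈-trans (∑-allRows (λ p → val (covers star p) * f p))
    (≈-trans (+-cong (sum-zero {f = ∑-block (λ p → val (covers star p) * f p)}
      (λ i → ∑-zeros i)) (*-identityˡ _)) (+-identityˡ _))
    where
    ∑-zeros : ∀ i → ∑-block (λ p → val (covers star p) * f p) i ≈ 0#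
    ∑-zeros i = ≈-trans (skip _ _) (≈-trans (skip _ _) (≈-trans (skip _ _) (skip _ _)))
  ∑-covers (lit i j) refl f = begin
    ∑ (allRows c) (λ p → val (covers (lit i j) p) * f p)
      ≈⟨ ∑-allRows (λ p → val (covers (lit i j) p) * f p) ⟩
    sum (∑-block (λ p → val (covers (lit i j) p) * f p)) + 0# * f star
      ≈⟨ +-cong (sum-cong-≋ at-block) (zeroˡ _) ⟩
    sum (λ i′ → unit i i′ * f (lit i′ j)) + 0#
      ≈⟨ +-identityʳ _ ⟩
    sum (λ i′ → unit i i′ * f (lit i′ j))
      ≈⟨ sum-unit i (λ i′ → f (lit i′ j)) ⟩
    f (lit i j) ∎
    where
    open ≈-Reasoning
    at-block : ∀ i′ → ∑-block (λ p → val (covers (lit i j) p) * f p) i′ ≈ unit i i′ * f (lit i′ j)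
    at-block i′ = ≈-trans (pick (i == i′)) (*-congʳ (≈-reflexive (indicator-unit i i′)))
      where
      select : ∀ j x → val (j == zero) * f (lit i′ zero) + (val (j == suc zero) * f (lit i′ (suc zero)) +
        (val (j == suc (suc zero)) * f (lit i′ (suc (suc zero))) + (0# * x + 0#))) ≈ f (lit i′ j)
      select zero             x = ≈-trans (+-cong (*-identityˡ _)
        (≈-trans (skip _ _) (≈-trans (skip _ _) (skip _ _)))) (+-identityʳ _)
      select (suc zero)       x = ≈-trans (skip _ _) (≈-trans (+-cong (*-identityˡ _)
        (≈-trans (skip _ _) (skip _ _))) (+-identityʳ _))
      select (suc (suc zero)) x = ≈-trans (skip _ _) (≈-trans (skip _ _)
        (≈-trans (+-cong (*-identityˡ _) (skip _ _)) (+-identityʳ _)))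
      pick : ∀ b → val (b ∧ (j == zero)) * f (lit i′ zero) + (val (b ∧ (j == suc zero)) * f (lit i′ (suc zero)) +
        (val (b ∧ (j == suc (suc zero))) * f (lit i′ (suc (suc zero))) + (0# * f (gad i′) + 0#))) ≈ val b * f (lit i′ j)
      pick true  = ≈-trans (select j (f (gad i′))) (≈-sym (*-identityˡ _))
      pick false = ≈-trans (skip _ _) (≈-trans (skip _ _) (≈-trans (skip _ _) (≈-trans (skip _ _) (≈-sym (zeroˡ _)))))

  not-both-chosen : ∀ i j i′ j′ → ¬ ((choice i == j) ≡ true × (choice i′ == j′) ≡ true) →
                    z (lit i j) * z (lit i′ j′) ≈ 0#
  not-both-chosen i j i′ j′ ¬both with choice i == j | choice i′ == j′
  ... | false | _     = zeroˡ _
  ... | true  | false = zeroʳ _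
  ... | true  | true  = contradiction (refl , refl) ¬both

  contradictory-values : ∀ ℓ ℓ′ → literalValue α ℓ ≡ true → literalValue α ℓ′ ≡ true → contradictory ℓ ℓ′ ≡ false
  contradictory-values (pos x) (pos y) p p′ = refl
  contradictory-values (neg x) (neg y) p p′ = refl
  contradictory-values (pos x) (neg y) p p′ with x == y in eq
  ... | false = refl
  ... | true with refl ← ==⇒≡ {i = x} {y} eq with α x
  contradictory-values (pos x) (neg y) p () | true | true
  contradictory-values (pos x) (neg y) () p′ | true | false
  contradictory-values (neg x) (pos y) p p′ with x == y in eq
  ... | false = refl
  ... | true with refl ← ==⇒≡ {i = x} {y} eq with α x
  contradictory-values (neg x) (pos y) () p′ | true | true
  contradictory-values (neg x) (pos y) p () | true | false

  -- Chosen literals of one clause coincide, and those of different clauses are both true under α,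
  -- hence not contradictory.
  z-incompatible : ∀ p q → compatible p q ≡ false → z p * z q ≈ 0#
  z-incompatible (lit i j) (lit i′ j′) e = not-both-chosen i j i′ j′ λ (p , p′) →
    both (==⇒≡ p , ==⇒≡ p′)
    where
    both : ¬ (choice i ≡ j × choice i′ ≡ j′)
    both (refl , refl) with i == i′ in ii
    ... | true with refl ← ==⇒≡ {i = i} {i′} ii = contradiction (trans (sym (==-refl (choice i))) e) λ ()
    ... | false = contradiction (trans (sym (cong not
      (contradictory-values (L i (choice i)) (L i′ (choice i′)) (chosen-true i) (chosen-true i′)))) e) λ ()

  weight-incompatible : ∀ p q → compatible p q ≡ false → weight (p , q) ≈ 0#
  weight-incompatible p q e with precedes p q
  ... | true  = z-incompatible p q e
  ... | false = ≈-refl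

  covers-refl : ∀ (a : Row c) → isGad a ≡ false → covers a a ≡ true
  covers-refl star      _ = refl
  covers-refl (lit i j) _ rewrite ==-refl i = ==-refl j

  weight-diagonal : ∀ a → isGad a ≡ false → weight (a , a) ≈ z a * z a
  weight-diagonal star      _ = ≈-refl
  weight-diagonal (lit i j) _
    rewrite Equivalence.to T-≡ (ℕ.≤⇒≤ᵇ (ℕ.≤-refl {toℕ i})) = ≈-refl

  weight-symmetrised : ∀ a b → isGad a ≡ false → isGad b ≡ false → covers a b ≡ false →
                       weight (a , b) + weight (b , a) ≈ z a * z b
  weight-symmetrised star      (lit i j)   _ _ _ = +-identityʳ _
  weight-symmetrised (lit i j) star        _ _ _ = ≈-trans (+-identityˡ _) (*-comm _ _)
  weight-symmetrised (lit i j) (lit i′ j′) _ _ e with toℕ i ≤ᵇ toℕ i′ in le | toℕ i′ ≤ᵇ toℕ i in ge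
  ... | true  | false = +-identityʳ _
  ... | false | true  = ≈-trans (+-identityˡ _) (*-comm _ _)
  ... | false | false with ℕ.≤-total (toℕ i) (toℕ i′)
  ...   | inj₁ p = contradiction (trans (sym le) (Equivalence.to T-≡ (ℕ.≤⇒≤ᵇ p))) λ ()
  ...   | inj₂ p = contradiction (trans (sym ge) (Equivalence.to T-≡ (ℕ.≤⇒≤ᵇ p))) λ ()
  -- Both orders hold only within one clause; by `e` the positions differ, so both terms vanish and
  -- so does the right side.
  weight-symmetrised (lit i j) (lit i′ j′) _ _ e | true | true =
    ≈-trans (+-congˡ (≈-trans (*-comm _ _) vanish)) (+-identityʳ _)
    where
    same : i ≡ i′
    same = toℕ-injective (ℕ.≤-antisym (ℕ.≤ᵇ⇒≤ _ _ (Equivalence.from T-≡ le)) (ℕ.≤ᵇ⇒≤ _ _ (Equivalence.from T-≡ ge)))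
    absurd : ¬ (choice i ≡ j × choice i′ ≡ j′)
    absurd (refl , refl) with refl ← same =
      contradiction (trans (sym (covers-refl (lit i (choice i)) refl)) e) λ ()
    vanish : z (lit i j) * z (lit i′ j′) ≈ 0#
    vanish = not-both-chosen i j i′ j′ λ (p , p′) → absurd (==⇒≡ p , ==⇒≡ p′)

  pairs : List (Row c × Row c)
  pairs = cartesian (allRows c) (allRows c)

  ∑-product : ∀ a b → isGad a ≡ false → isGad b ≡ false →
    ∑ pairs (λ (p , q) → weight (p , q) * (val (covers a p) * val (covers b q))) ≈ weight (a , b)
  ∑-product a b na nb = begin
    ∑ pairs (λ (p , q) → weight (p , q) * (val (covers a p) * val (covers b q)))
      ≈⟨ ∑-cartesian (allRows c) (allRows c) (λ (p , q) → weight (p , q) * (val (covers a p) * val (covers b q))) ⟩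
    ∑ (allRows c) (λ p → ∑ (allRows c) (λ q → weight (p , q) * (val (covers a p) * val (covers b q))))
      ≈⟨ ∑-cong (allRows c) (λ p → ≈-trans
           (∑-cong (allRows c) (λ q → ≈-trans (*-comm (weight (p , q)) _) (*-assoc (val (covers a p)) (val (covers b q)) (weight (p , q)))))
           (≈-trans (∑-*ˡ (allRows c) (val (covers a p)) (λ q → val (covers b q) * weight (p , q)))
             (*-congˡ (∑-covers b nb (λ q → weight (p , q)))))) ⟩
    ∑ (allRows c) (λ p → val (covers a p) * weight (p , b))
      ≈⟨ ∑-covers a na (λ p → weight (p , b)) ⟩
    weight (a , b) ∎
    where open ≈-Reasoning

  total : Row c → Row c → Carrier
  total a b = ∑ pairs (λ g → weight g * val (gen g a b))

  -- The compatibility test drops out because the weight of an incompatible pair is already zero.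
  -- The truth of the chosen literals enters here.
  total-pairing : ∀ a b → isGad b ≡ false →
                  total a b ≈ ∑ pairs (λ g → weight g * val (pairing g a b))
  total-pairing a b nb = ∑-cong pairs term
    where
    term : ∀ g → weight g * val (gen g a b) ≈ weight g * val (pairing g a b)
    term g@(p , q) rewrite gen-nongad g a b nb with compatible p q in e
    ... | true  = ≈-refl
    ... | false = ≈-trans (zeroʳ _) (≈-sym (≈-trans (*-congʳ (weight-incompatible p q e)) (zeroˡ _)))

  val-∨ : ∀ x y u v → ¬ (x ≡ true × v ≡ true) → val (x ∧ y ∨ u ∧ v) ≈ val x * val y + val u * val v
  val-∨ true  true  u     false ¬both = ≈-sym (≈-trans (+-cong (*-identityˡ _) (zeroʳ _)) (+-identityʳ _))
  val-∨ true  false u     false ¬both = ≈-trans (≈-reflexive (cong val (∧-false u)))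
                                       (≈-sym (≈-trans (+-cong (zeroʳ _) (zeroʳ _)) (+-identityʳ _)))
    where
    ∧-false : ∀ u → u ∧ false ≡ false
    ∧-false true  = refl
    ∧-false false = refl
  val-∨ true  y     u     true ¬both = contradiction (refl , refl) ¬both
  val-∨ false y     u     v ¬both = ≈-trans (val-∧ u v) (≈-sym (≈-trans (+-congʳ (zeroˡ _)) (+-identityˡ _)))

  -- For a = b the two disjuncts of `pairing` coincide and count once. For a ≠ b they exclude each
  -- other, and the weights of both orders add up.
  total-nongad : ∀ a b → isGad a ≡ false → isGad b ≡ false → total a b ≈ z a * z b
  total-nongad a b na nb with covers a b in e
  ... | true with refl ← covers⇒≡ a b na e = begin
    total a a                                                   ≈⟨ total-pairing a a na ⟩
    ∑ pairs (λ g → weight g * val (pairing g a a))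
      ≈⟨ ∑-cong pairs (λ (p , q) → *-congˡ {weight (p , q)} (≈-trans
           (≈-reflexive (cong val (same (covers a p) (covers a q)))) (val-∧ (covers a p) _))) ⟩
    ∑ pairs (λ (p , q) → weight (p , q) * (val (covers a p) * val (covers a q)))
                                                                ≈⟨ ∑-product a a na na ⟩
    weight (a , a)                                              ≈⟨ weight-diagonal a na ⟩
    z a * z a                                                   ∎
    where
    open ≈-Reasoning
    same : ∀ x y → x ∧ y ∨ y ∧ x ≡ x ∧ y
    same true  true  = refl
    same true  false = refl
    same false true  = refl
    same false false = refl
  ... | false = begin
    total a b                                                   ≈⟨ total-pairing a b nb ⟩
    ∑ pairs (λ g → weight g * val (pairing g a b))
      ≈⟨ ∑-cong pairs (λ (p , q) → ≈-trans
           (*-congˡ {weight (p , q)} (val-∨ (covers a p) (covers b q) (covers a q) (covers b p) (distinct p)))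
           (≈-trans (distribˡ (weight (p , q)) _ _) (+-congˡ (*-congˡ {weight (p , q)} (*-comm _ _))))) ⟩
    ∑ pairs (λ (p , q) → straight p q + swapped p q)              ≈⟨ ∑-+ pairs (λ (p , q) → straight p q) (λ (p , q) → swapped p q) ⟩
    ∑ pairs (λ (p , q) → straight p q) + ∑ pairs (λ (p , q) → swapped p q)
      ≈⟨ +-cong (∑-product a b na nb) (∑-product b a nb na) ⟩
    weight (a , b) + weight (b , a)                             ≈⟨ weight-symmetrised a b na nb e ⟩
    z a * z b                                                   ∎
    where
    open ≈-Reasoning
    straight swapped : Row c → Row c → Carrier
    straight p q  = weight (p , q) * (val (covers a p) * val (covers b q))
    swapped p q = weight (p , q) * (val (covers b p) * val (covers a q))
    distinct : ∀ p → ¬ (covers a p ≡ true × covers b p ≡ true)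
    distinct p (ap , bp) with refl ← trans (sym (covers⇒≡ a p na ap)) (covers⇒≡ b p nb bp) =
      contradiction (trans (sym (covers-refl a na)) e) λ ()

  group-z : ∀ i → group z i ≈ 0#
  group-z i with choice i
  ... | zero           = ≈-trans (+-congˡ (≈-trans (+-congˡ (+-identityˡ _)) (+-identityʳ _))) (-‿inverseʳ _)
  ... | suc zero       = ≈-trans (+-congˡ (≈-trans (+-identityˡ _) (+-identityʳ _))) (-‿inverseʳ _)
  ... | suc (suc zero) = ≈-trans (+-congˡ (≈-trans (+-identityˡ _) (+-identityˡ _))) (-‿inverseʳ _)

  -- The row of `gad i` inherits the factor `group z i`, which is 1 - 1 because exactly one literal
  -- of the clause is chosen.
  total-gad : ∀ i b → isGad b ≡ false → total (gad i) b ≈ 0#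
  total-gad i b nb = begin
    total (gad i) b
      ≈⟨ ∑-cong pairs (λ g → ≈-trans (*-congˡ {weight g} (gen-group g i b nb)) (group-*ˡ (weight g) (λ a → val (gen g a b)))) ⟩
    ∑ pairs (λ g → group (λ a → weight g * val (gen g a b)) i)
      ≈⟨ ≈-trans (∑-+ pairs (part star) (λ g → part (lit i zero) g + (part (lit i (suc zero)) g + part (lit i (suc (suc zero))) g)))
         (+-congˡ (≈-trans (∑-+ pairs (part (lit i zero)) (λ g → part (lit i (suc zero)) g + part (lit i (suc (suc zero))) g))
           (+-congˡ (∑-+ pairs (part (lit i (suc zero))) (part (lit i (suc (suc zero)))))))) ⟩
    group (λ a → total a b) i
      ≈⟨ +-cong (total-nongad star b refl nb) (+-cong (total-nongad (lit i zero) b refl nb)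
           (+-cong (total-nongad (lit i (suc zero)) b refl nb) (total-nongad (lit i (suc (suc zero))) b refl nb))) ⟩
    group (λ a → z a * z b) i         ≈⟨ group-*ʳ z (z b) ⟩
    group z i * z b                   ≈⟨ *-congʳ (group-z i) ⟩
    0# * z b                          ≈⟨ zeroˡ _ ⟩
    0#                                ∎
    where
    open ≈-Reasoning
    part : Row c → Row c × Row c → Carrier
    part a g = weight g * val (gen g a b)
    group-*ˡ : ∀ k f → k * group f i ≈ group (λ a → k * f a) i
    group-*ˡ k f = ≈-trans (distribˡ k _ _) (+-congˡ (≈-trans (distribˡ k _ _) (+-congˡ (distribˡ k _ _))))
    group-*ʳ : ∀ f k → group (λ a → f a * k) i ≈ group f i * k
    group-*ʳ f k = ≈-sym (≈-trans (distribʳ k _ _) (+-congˡ (≈-trans (distribʳ k _ _) (+-congˡ (distribʳ k _ _)))))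

  total-comm : ∀ a b → total a b ≈ total b a
  total-comm a b = ∑-cong pairs (λ g → *-congˡ {weight g} (≈-reflexive (cong val (gen-comm g a b))))

  total-≈ : ∀ a b → total a b ≈ z a * z b
  total-≈ (gad i)     (gad i′)    = ≈-trans
    (∑-zero pairs (λ g → ≈-trans (*-congˡ {weight g} (≈-reflexive (cong val (gen-gad g i i′)))) (zeroʳ (weight g)))) (≈-sym (zeroˡ _))
  total-≈ (gad i)     star        = ≈-trans (total-gad i star refl) (≈-sym (zeroˡ _))
  total-≈ (gad i)     (lit i′ j)  = ≈-trans (total-gad i (lit i′ j) refl) (≈-sym (zeroˡ _))
  total-≈ star        (gad i)     = ≈-trans (total-comm star (gad i))
    (≈-trans (total-gad i star refl) (≈-sym (zeroʳ _)))
  total-≈ (lit i′ j)  (gad i)     = ≈-trans (total-comm (lit i′ j) (gad i))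
    (≈-trans (total-gad i (lit i′ j) refl) (≈-sym (zeroʳ _)))
  total-≈ star        star        = total-nongad star star refl refl
  total-≈ star        (lit i j)   = total-nongad star (lit i j) refl refl
  total-≈ (lit i j)   star        = total-nongad (lit i j) star refl refl
  total-≈ (lit i j)   (lit i′ j′) = total-nongad (lit i j) (lit i′ j′) refl refl

  interchange : ∀ w x y v → w * x * (y * v) ≈ w * y * (x * v)
  interchange w x y v = begin
    w * x * (y * v)    ≈⟨ *-assoc w x _ ⟩
    w * (x * (y * v))  ≈⟨ *-congˡ (≈-trans (≈-sym (*-assoc x y v)) (≈-trans (*-congʳ (*-comm x y)) (*-assoc y x v))) ⟩
    w * (y * (x * v))  ≈⟨ *-assoc w y _ ⟨
    w * y * (x * v)    ∎
    where open ≈-Reasoning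

  -- Weights and entries are products over the tensor factors, so the sum over all words splits into
  -- a product of t sums `total`.
  ∑-entry : ∀ {t} (r s : Vec (Row c) t) →
            ∑ (powers pairs t) (λ γ → Weight γ * val (entry γ r s)) ≈ Z r * Z s
  ∑-entry []            []      = +-identityʳ _
  ∑-entry {suc t} (a ∷ r) (b ∷ s) = begin
    ∑ (powers pairs (suc t)) (λ γ → Weight γ * val (entry γ (a ∷ r) (b ∷ s)))
      ≈⟨ ∑-powers pairs t {h = λ γ → Weight γ * val (entry γ (a ∷ r) (b ∷ s))} (λ g γ → ≈-trans (*-congˡ (val-∧ (gen g a b) (entry γ r s)))
           (interchange (weight g) (Weight γ) _ _)) ⟩
    total a b * ∑ (powers pairs t) (λ γ → Weight γ * val (entry γ r s))
      ≈⟨ *-cong (total-≈ a b) (∑-entry r s) ⟩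
    z a * z b * (Z r * Z s)  ≈⟨ interchange (z a) (z b) (Z r) (Z s) ⟩
    z a * Z r * (z b * Z s)  ∎
    where open ≈-Reasoning

-- The reduction, its correctness and its parameters

any-lookup : ∀ {a p} {X : Set a} {P : X → Set p} {m} (v : Vec X m) j → P (Vec.lookup v j) → VecAny.Any P v
any-lookup (x ∷ v) zero    p = here p
any-lookup (x ∷ v) (suc j) p = there (any-lookup v j p)

lookup-any : ∀ {a p} {X : Set a} {P : X → Set p} {m} {v : Vec X m} → VecAny.Any P v → ∃[ j ] P (Vec.lookup v j)
lookup-any (here p)  = zero , p
lookup-any (there q) with j , p ← lookup-any q = suc j , p

all-lookup : ∀ {a p} {X : Set a} {P : X → Set p} (xs : List X) → (∀ i → P (List.lookup xs i)) → All P xs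
all-lookup []       p = []
all-lookup (x ∷ xs) p = p zero ∷ all-lookup xs (λ i → p (suc i))

encode-lookup : ∀ {a b} {X : Set a} {Y : Set b} (enc : Y → Tree) (g : X → Y) (enc′ : X → Tree) →
                (∀ x → enc (g x) ≡ enc′ x) → ∀ xs →
                encodeVector enc (λ l → g (List.lookup xs l)) ≡ encodeList enc′ xs
encode-lookup enc g enc′ eq []       = refl
encode-lookup enc g enc′ eq (x ∷ xs) = cong₂ _∙_ (eq x) (encode-lookup enc g enc′ eq xs)

encodeℕ-length : ∀ {a} {X : Set a} (xs : List X) → encodeℕ (length xs) ≡ encodeList (λ _ → nil) xs
encodeℕ-length []       = refl
encodeℕ-length (x ∷ xs) = cong (nil ∙_) (encodeℕ-length xs)

1<2^ : ∀ {r} → 1 ≤ r → 1 < 2 ^ r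
1<2^ {suc r} _ = ℕ.*-monoʳ-≤ 2 (ℕ.m^n>0 2 r)

module Reduction {c ℓ₁ ℓ₂ : Level} {q : ℕ} (F : FiniteField c ℓ₁ ℓ₂ q) (t : ℕ) where

  open LinearAlgebra F using (Matrix; NonZeroMatrix; HasRank; RankAtMost)
  open Field F

  module _ {n} (φ : 3CNF n) where

    open Run φ using (literals) renaming (c to clauseCount)
    open Weighted F literals using (val; tensor; vanishing; Covered)
    open Generators literals using (entry)

    -- Reversed like the lists produced by `mapTm`, so that the encoded subspace is literally the
    -- output of the program.
    rows : List (Vec (Row clauseCount) t)
    rows = reverse (powers (allRows clauseCount) t)

    gens : List (Vec (Row clauseCount × Row clauseCount) t)
    gens = reverse (powers (cartesian (allRows clauseCount) (allRows clauseCount)) t)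

    subspace : MatrixSubspace F
    subspace = record
      { N          = length rows
      ; size       = length gens
      ; generators = λ l (i , j) → val (entry (List.lookup gens l) (List.lookup rows i) (List.lookup rows j))
      }

    open MatrixSubspace subspace using (N; member)

    encode-subspace : encodeSubspace subspace ≡ Run.output φ t (toℕ (to 0#)) (toℕ (to 1#))
    encode-subspace = cong₂ _∙_ (encodeℕ-length rows)
      (encode-lookup _ (λ γ (i , j) → val (entry γ (List.lookup rows i) (List.lookup rows j))) _ (λ γ →
        encode-lookup _ (λ r j → val (entry γ r (List.lookup rows j))) _ (λ r →
          encode-lookup _ (λ s → val (entry γ r s)) _ (λ s → symbol (entry γ r s)) rows) rows) gens)
      where
      symbol : ∀ b → encodeElement {F = F} (val b) ≡ Run.symbol φ (toℕ (to 0#)) (toℕ (to 1#)) b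
      symbol true  = refl
      symbol false = refl

    length-rows : N ≡ (1 ℕ.+ 4 ℕ.* clauseCount) ^ t
    length-rows = trans (length-reverse (powers (allRows clauseCount) t))
      (trans (length-powers (allRows clauseCount) t) (cong (_^ t) (length-allRows clauseCount)))

    row∈ : ∀ r → r ∈ rows
    row∈ r = reverse⁺ (∈-powers ∈-allRows r)

    position : Vec (Row clauseCount) t → Fin N
    position r = Any.index (row∈ r)

    lookup-position : ∀ r → List.lookup rows (position r) ≡ r
    lookup-position r = sym (lookup-index (row∈ r))

    yes-case : 1 < q → Satisfiable φ → ∃[ M ] member M × NonZeroMatrix M × HasRank M 1
    yes-case 1<q (α , sat) =
        M
      , ((λ l → Weight (List.lookup gens l)) , λ (i , j) → ≈-sym (≈-trans
          (∑-reverse (powers pairs t) (λ γ → Weight γ * val (entry γ (List.lookup rows i) (List.lookup rows j))))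
          (∑-entry (List.lookup rows i) (List.lookup rows j))))
      , (λ M≈0 → 1≉0 1<q (≈-trans (≈-sym (≈-trans (*-cong unit-o unit-o) (*-identityˡ 1#))) (M≈0 (o , o))))
      , outer-rank M (λ i → Z (List.lookup rows i)) o unit-o (λ i j → ≈-refl)
      where
      chosen : ∀ i → ∃[ j ] literalValue α (literals i j) ≡ true
      chosen i = lookup-any (All.lookup sat (∈-lookup i))
      open Completeness F literals α (λ i → proj₁ (chosen i)) (λ i → proj₂ (chosen i))
      open Sums F
      M : Matrix N N
      M (i , j) = Z (List.lookup rows i) * Z (List.lookup rows j)
      Z-star : ∀ t → Z (Vec.replicate t star) ≈ 1#
      Z-star zero    = ≈-refl
      Z-star (suc t) = ≈-trans (*-identityˡ _) (Z-star t)
      o : Fin N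
      -- At the all-`star` index Z is 1, which gives a nonzero entry of M and the column that
      -- `outer-rank` needs.
      o = position (Vec.replicate t star)
      unit-o : Z (List.lookup rows o) ≈ 1#
      unit-o = ≈-trans (≈-reflexive (cong Z (lookup-position (Vec.replicate t star)))) (Z-star t)

    no-case : ∀ {k} → k < 2 ^ t → ¬ Satisfiable φ → ¬ (∃[ M ] member M × NonZeroMatrix M × RankAtMost M k)
    no-case k<2^t unsat (M , (a , M≈) , M≢0 , ρ , ρ≤k , rank) = M≢0 λ (i , j) →
      ≈-trans (M≈ (i , j)) (vanishing ∈-allRows not-covered t a (List.lookup gens) no-triangle _ _)
      where
      not-covered : ¬ Covered
      not-covered (α , p) = unsat (α , all-lookup (3CNF.clauses φ) λ i → any-lookup _ (proj₁ (p i)) (proj₂ (p i)))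
      m = tensor a (List.lookup gens)
      no-triangle : ¬ (∃[ ps ] length ps ≡ 2 ^ t × Triangular m ps)
      no-triangle (ps , len , u) = contradiction (ℕ.≤-trans (ℕ.≤-trans k<2^t (ℕ.≤-trans
        (ℕ.≤-reflexive (trans (sym len) (sym (length-map _ ps))))
        (triangular-rank M rank _ (triangular-map position position entries ps u)))) ρ≤k) (ℕ.<-irrefl refl)
        where
        entries : ∀ r s → M (position r , position s) ≈ m r s
        entries r s = ≈-trans (M≈ _) (≈-reflexive (cong₂ m (lookup-position r) (lookup-position s)))

maps-within : ∀ {m} {P : Program (suc m)} {d e T T′} → T ≤ T′ → P maps d to e within T → P maps d to e within T′
maps-within T≤T′ (σ , t , run , t≤T) = σ , t , run , ℕ.≤-trans t≤T T≤T′

module Bounds {c ℓ₁ ℓ₂ : Level} {q : ℕ} (F : FiniteField c ℓ₁ ℓ₂ q) where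

  open Field F using (to; 0#; 1#)
  open Reduction F using (subspace; encode-subspace; length-rows)
  open MatrixSubspace using (N)

  c₀ c₁ : ℕ
  c₀ = toℕ (to 0#)
  c₁ = toℕ (to 1#)

  maps-subspace : ∀ t {n} (φ : 3CNF n) →
    (V ≔ cons (var A) (var V) ⨾ compile (mainTm t c₀ c₁))
    maps encodeFormula φ to encodeSubspace (subspace t φ) within totalBound c₀ c₁ t (2 ℕ.+ n)
  maps-subspace t {n} φ rewrite encode-subspace t φ =
    maps-to (mainTm t c₀ c₁) (encodeFormula φ) (_⊢_⇒_within_.value run) (_⊢_⇒_within_.bound run)
    where
    run = Run.⊢main φ (clauses-≤ φ) (ℕ.+-monoʳ-≤ 3 (ℕ.+-mono-≤ (clauses-≤ φ) (ℕ.m≤n+m n 2))) t c₀ c₁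

  N-≤ : ∀ t {n} (φ : 3CNF n) → N (subspace t φ) ≤ rowBound (2 ℕ.+ n) ^ t
  N-≤ t φ = ℕ.≤-trans (ℕ.≤-reflexive (length-rows t φ))
    (ℕ.^-monoˡ-≤ t (s≤s (ℕ.*-monoʳ-≤ 4 (clauses-≤ φ))))

  -- Opaque because the numerals in these degrees are too large to unfold.
  opaque
    timePoly : Polynomial (totalBound c₀ c₁)
    timePoly = poly-totalBound c₀ c₁

    sizePoly : Polynomial (λ t b → rowBound b ^ t)
    sizePoly = poly-^ poly-rowBound

  -- A single constant has to serve the running time and the dimension; the sum dominates both
  -- degrees.
  exponent : ℕ
  exponent = Polynomial.degree timePoly ℕ.+ Polynomial.degree sizePoly

  module _ (k : ℕ) (1≤k : 1 ≤ k) where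

    t : ℕ
    t = ⌈log₂ suc k ⌉

    1≤t : 1 ≤ t
    1≤t = 0<⌈log₂⌉ (s≤s 1≤k)

    ^-exponent : ∀ n {d} → d ≤ exponent → (2 ℕ.+ n) ^ (d ℕ.* t) ≤ n^O[log k ] exponent n
    ^-exponent n d≤ = ℕ.^-monoʳ-≤ (2 ℕ.+ n) (ℕ.*-monoˡ-≤ t d≤)

    computable : ComputableWithin (subspace t) (n^O[log k ] exponent)
    computable = 2 , _ , λ {n} φ → maps-within
      (ℕ.≤-trans (Polynomial.bounded timePoly t (2 ℕ.+ n) 1≤t (s≤s (s≤s z≤n)))
        (^-exponent n (ℕ.m≤m+n (Polynomial.degree timePoly) _)))
      (maps-subspace t φ)

    small : ∀ {n} (φ : 3CNF n) → N (subspace t φ) ≤ n^O[log k ] exponent n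
    small {n} φ = ℕ.≤-trans (N-≤ t φ)
      (ℕ.≤-trans (Polynomial.bounded sizePoly t (2 ℕ.+ n) 1≤t (s≤s (s≤s z≤n)))
        (^-exponent n (ℕ.m≤n+m _ (Polynomial.degree timePoly))))

theorem3p1 :
  ∀ {c ℓ₁ ℓ₂} (r : ℕ) → 1 ≤ r → (F : FiniteField c ℓ₁ ℓ₂ (2 ^ r)) →
  let open LinearAlgebra F
      open MatrixSubspace
  in
  Σ[ C ∈ ℕ ] ∀ (k : ℕ) → 1 ≤ k →
  Σ[ 𝓛 ∈ (∀ {n} → 3CNF n → MatrixSubspace F) ]
    ComputableWithin 𝓛 (n^O[log k ] C)
    × (∀ {n} (φ : 3CNF n) →
        N (𝓛 φ) ≤ n^O[log k ] C n
        × (Satisfiable φ → ∃[ M ] member (𝓛 φ) M × NonZeroMatrix M × HasRank M 1)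
        × (¬ Satisfiable φ → ¬ (∃[ M ] member (𝓛 φ) M × NonZeroMatrix M × RankAtMost M k)))
theorem3p1 r 1≤r F = exponent , λ k 1≤k →
    subspace ⌈log₂ suc k ⌉
  , computable k 1≤k
  , λ φ → small k 1≤k φ
        , yes-case ⌈log₂ suc k ⌉ φ (1<2^ 1≤r)
        , no-case ⌈log₂ suc k ⌉ φ (n≤2^⌈log₂n⌉ (suc k))
  where
  open Bounds F
  open Reduction F using (subspace; yes-case; no-case)
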